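{- Let $n$ be a positive integer, $p$ a prime not dividing $n$, and $m\ge2$. Then $$P_{p^mn}(s,t)=\begin{cases}P_{p^{m-1}n}(s^2+2t,\,-t^2) & \text{if } p=2,\\ P_{p^{m-1}n}\big(s\,P_{2p}(s,t),\,t^p\big) & \text{if } p\ge3.\end{cases}$$
   Context: Let $\Phi_n(q)$ be the $n$th cyclotomic polynomial and $\phi$ the Euler totient function. For $n\ge 2$, $\Phi_n(q)$ is palindromic of degree $\phi(n)$ with constant term $1$, so there are unique complex numbers $\gamma_j$ with $\Phi_n(q)=\sum_{0\le j\le \phi(n)/2}\gamma_j q^j(1+q)^{\phi(n)-2j}$; the $n$th Lucas atom is $P_n(s,t)=\sum_j \gamma_j s^{\phi(n)-2j}(-t)^j$ for $n\ge 2$, and $P_1(s,t)=1$. $P_n(a,b)$ denotes $P_n$ with $s,t$ replaced by $a,b$. -}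

module Defs where

open import Level using (Level)
open import Data.Bool using (Bool; true; false; if_then_else_)
open import Data.Nat as ℕ using (ℕ; zero; suc; _∸_; ⌊_/2⌋)
open import Data.Integer as ℤ using (ℤ; +_; -[1+_])
open import Data.List using (List; []; _∷_; _++_; map; foldr; filter; length; reverse; replicate; upTo; zip; drop)
open import Data.Product using (_,_; proj₁; proj₂)
open import Data.Nat.GCD using (gcd)
open import Data.Nat.Divisibility using (_∣?_)
open import Relation.Nullary.Decidable using (does)
open import Algebra.Bundles using (CommutativeRing)

-- Euler totient: φ(n) = #{ k ∈ {0,…,n-1} | gcd k n = 1 }
-- (for n = 1 this counts k = 0, giving φ(1) = 1)

totient : ℕ → ℕ
totient n = length (filter (λ k → gcd k n ℕ.≟ 1) (upTo n))

-- Integer polynomials in one variable q, as coefficient lists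
-- (lowest degree first).

Poly : Set
Poly = List ℤ

infixl 6 _⊕_
infixl 7 _⊗_

_⊕_ : Poly → Poly → Poly
[] ⊕ q = q
(a ∷ p) ⊕ [] = a ∷ p
(a ∷ p) ⊕ (b ∷ q) = (a ℤ.+ b) ∷ (p ⊕ q)

scale : ℤ → Poly → Poly
scale c = map (c ℤ.*_)

_⊗_ : Poly → Poly → Poly
[] ⊗ q = []
(a ∷ p) ⊗ q = scale a q ⊕ (+ 0 ∷ (p ⊗ q))

shift : ℕ → Poly → Poly
shift k p = replicate k (+ 0) ++ p

ppow : Poly → ℕ → Poly
ppow p zero = + 1 ∷ []
ppow p (suc k) = p ⊗ ppow p k

coeff : ℕ → Poly → ℤ
coeff _ [] = + 0
coeff zero (a ∷ _) = a
coeff (suc i) (_ ∷ p) = coeff i p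

qPowMinusOne : ℕ → Poly
qPowMinusOne zero = []
qPowMinusOne (suc N) = ℤ.- (+ 1) ∷ (replicate N (+ 0) ++ (+ 1 ∷ []))

-- Exact division by a monic polynomial (coefficient lists highest degree
-- first); fuel bounds the number of steps.
subPrefix : ℤ → List ℤ → List ℤ → List ℤ
subPrefix c [] a = a
subPrefix c (x ∷ d) [] = []
subPrefix c (x ∷ d) (y ∷ a) = (y ℤ.- c ℤ.* x) ∷ subPrefix c d a

divH : ℕ → List ℤ → List ℤ → List ℤ
divH zero d a = []
divH (suc f) d [] = []
divH (suc f) d (c ∷ a) =
  if length (c ∷ a) ℕ.<ᵇ length d then []
  else c ∷ divH f d (drop 1 (subPrefix c d (c ∷ a)))

divMonic : Poly → Poly → Poly
divMonic a d = reverse (divH (length a) (reverse d) (reverse a))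

-- Cyclotomic polynomials, via  q^N - 1 = ∏_{d ∣ N} Φ_d(q):
-- Φ_N = (q^N - 1) / ∏_{d ∣ N, d < N} Φ_d.

cycloNext : ℕ → List Poly → Poly
cycloNext N prev =
  divMonic (qPowMinusOne N)
    (foldr _⊗_ (+ 1 ∷ [])
      (map proj₂ (filter (λ dΦ → proj₁ dΦ ∣? N) (zip (map suc (upTo (length prev))) prev))))

cycloList : ℕ → List Poly
cycloList zero = []
cycloList (suc n) = cycloList n ++ (cycloNext (suc n) (cycloList n) ∷ [])

-- Φ n  (Φ 0 is a dummy value; only n ≥ 1 is meaningful)
Φ : ℕ → Poly
Φ zero = + 1 ∷ []
Φ (suc n) = cycloNext (suc n) (cycloList n)

-- The coefficients γ_j (0 ≤ j ≤ φ(n)/2) with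
--   Φ_n(q) = Σ_j γ_j q^j (1+q)^(φ(n) - 2j).
-- Computed by peeling: γ_j is the q^j–coefficient of the remainder
-- Φ_n - Σ_{i<j} γ_i q^i (1+q)^(φ(n)-2i).

onePlusQ : Poly
onePlusQ = + 1 ∷ + 1 ∷ []

gammaLoop : ℕ → ℕ → ℕ → Poly → List ℤ
gammaLoop φn zero j r = []
gammaLoop φn (suc c) j r =
  coeff j r ∷
  gammaLoop φn c (suc j)
    (r ⊕ scale (ℤ.- coeff j r) (shift j (ppow onePlusQ (φn ∸ (j ℕ.+ j)))))

gammas : ℕ → List ℤ
gammas n = gammaLoop (totient n) (suc ⌊ totient n /2⌋) 0 (Φ n)

-- Evaluation of the Lucas atom P_n(s,t) = Σ_j γ_j s^(φ(n)-2j) (-t)^j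
-- at elements s, t of an arbitrary commutative ring; P_1 = 1.

module _ {c ℓ : Level} (R : CommutativeRing c ℓ) where
  open CommutativeRing R

  fromℕR : ℕ → Carrier
  fromℕR zero = 0#
  fromℕR (suc n) = 1# + fromℕR n

  fromℤR : ℤ → Carrier
  fromℤR (+ n) = fromℕR n
  fromℤR -[1+ n ] = - fromℕR (suc n)

  powR : Carrier → ℕ → Carrier
  powR x zero = 1#
  powR x (suc k) = x * powR x k

  lucasSum : ℕ → ℕ → List ℤ → Carrier → Carrier → Carrier
  lucasSum φn j [] s t = 0#
  lucasSum φn j (γ ∷ γs) s t =
    fromℤR γ * powR s (φn ∸ (j ℕ.+ j)) * powR (- t) j + lucasSum φn (suc j) γs s t

  lucas : ℕ → Carrier → Carrier → Carrier
  lucas (suc zero) s t = 1#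
  lucas n s t = lucasSum (totient n) 0 (gammas n) s t

{-# OPTIONS --safe #-}

-- For x + y = s and x y = -t, the Lucas atom P_N(s, t) is the homogenization
-- y^φ(N) Φ_N(x / y), since peeling off the γ_j leaves nothing of a palindromic polynomial.
-- If p divides M then Φ_{pM}(q) = Φ_M(q^p), so P_{pM}(s, t) is P_M evaluated at the
-- parameters s′ = x^p + y^p and t′ = -(x y)^p. For p = 2 these are s² + 2t and -t²;
-- for odd p one has x^p + y^p = (x + y) P_{2p}(s, t), because Φ_2(q^p) = Φ_2(q) Φ_{2p}(q).
-- Such x and y exist in the free quadratic extension R[X] / (X² - s X - t).
--
-- Both properties of Φ_N (palindromicity and the substitution rule) come from
-- ∏_{d ∣ N} Φ_d = q^N - 1, which determines the Φ_d uniquely. That this product formula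
-- survives the exact division in the definition of Φ_N needs the product of the Φ_d with
-- d ∣ N, d < N to divide q^N - 1: any two of them generate an ideal of ℤ[q] containing
-- a nonzero integer, and their constant terms are units, so such integers can be cancelled.

module Submission where

open import Defs
open import Data.Bool using (true; false)
open import Level using (Level; _⊔_; 0ℓ)
open import Data.Nat using (ℕ; zero; suc; _+_; _≤_; _<_; _∸_; _^_; _*_; z≤n; s≤s; s≤s⁻¹; _≟_; _≤?_; ⌊_/2⌋; NonZero; >-nonZero; ≢-nonZero; nonTrivial⇒n>1)
open import Data.Nat.Properties
open import Data.Nat.Divisibility
open import Data.Nat.GCD
open import Data.Nat.Primality using (Prime; prime⇒nonZero; prime⇒nonTrivial; prime⇒irreducible)
open import Data.Nat.Coprimality using (Coprime; coprime-divisor)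
import Data.Nat as ℕ
open import Data.Integer as ℤ using (ℤ; +_; -[1+_])
import Data.Integer.Properties as ℤₚ
open import Data.List using (List; []; _∷_; _++_; map; foldr; filter; length; reverse; replicate; upTo; zip; _∷ʳ_)
import Data.List.Properties as Listₚ
open import Data.Product using (_×_; _,_; proj₁; proj₂; ∃)
open import Data.Sum using (_⊎_; inj₁; inj₂; [_,_]′)
open import Function using (_∘_; id)
open import Relation.Nullary using (¬_; Dec; yes; no; contradiction; ¬?)
open import Relation.Binary.PropositionalEquality as ≡ using (_≡_; _≢_; cong; cong₂; subst; module ≡-Reasoning)
open import Relation.Binary.Structures using (IsEquivalence)
open import Algebra.Bundles using (CommutativeRing; CommutativeMonoid)
import Relation.Binary.Reasoning.Setoid as SetoidReasoning
import Algebra.Properties.Ring as RingProperties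
import Algebra.Properties.CommutativeSemigroup as CSProperties
import Algebra.Solver.Ring.NaturalCoefficients.Default as NatCoeffSolver
import Algebra.Solver.Ring as RingSolver
open import Algebra.Solver.Ring.AlmostCommutativeRing using (fromCommutativeRing; _-Raw-AlmostCommutative⟶_)
open import Data.Maybe using (Maybe; just; nothing)
open import Algebra.Morphism.Structures using (IsRingHomomorphism)

-- Folds over ranges and divisors

-- Two cyclotomic polynomials need not be comaximal over ℤ: Φ_1 and Φ_2 generate an ideal that
-- contains 2 but not 1. Comaximality therefore only shows that an integer multiple of a cofactor is
-- divisible, and removing that integer is a separate argument on coefficients. A second obstacle is
-- that `Φ` comes from long division of coefficient lists, whose outcome depends on lengths and not
-- only on the polynomials. The degree of the quotient must be known before dividing; it comes from
-- the sum of the totients over the divisors of N. Degree and product formula hence go through one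
-- common induction. The ring R is arbitrary, possibly with torsion or zero divisors. All
-- cancellation of factors takes place in ℤ, ℕ or ℤ[q], and only polynomial identities are carried
-- over to R.

divisor-positive : ∀ {d N} → 1 ≤ N → d ∣ N → 1 ≤ d
divisor-positive {zero}  1≤N 0∣N = contradiction (0∣⇒≡0 0∣N) (m<n⇒n≢0 1≤N)
divisor-positive {suc d} _   _   = s≤s z≤n

module RangeFold {c ℓ} (M : CommutativeMonoid c ℓ) where
  open CommutativeMonoid M
  open SetoidReasoning setoid
  open CSProperties commutativeSemigroup using (interchange)

  fold : ℕ → (ℕ → Carrier) → Carrier
  fold zero    f = ε
  fold (suc n) f = fold n f ∙ f n

  when : {P : Set} → Dec P → Carrier → Carrier
  when (yes _) x = x
  when (no _)  x = ε

  when-yes : {P : Set} (d : Dec P) {x : Carrier} → P → when d x ≈ x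
  when-yes (yes _) p = refl
  when-yes (no ¬p) p = contradiction p ¬p

  when-no : {P : Set} (d : Dec P) {x : Carrier} → ¬ P → when d x ≈ ε
  when-no (yes p) ¬p = contradiction p ¬p
  when-no (no _)  ¬p = refl

  when-cong : {P Q : Set} (d : Dec P) (e : Dec Q) {x y : Carrier} →
              (P → Q) → (Q → P) → (Q → x ≈ y) → when d x ≈ when e y
  when-cong (yes p) e f g h = trans (h (f p)) (sym (when-yes e (f p)))
  when-cong (no ¬p) e f g h = sym (when-no e (¬p ∘ g))

  fold-cong : ∀ n {f g} → (∀ k → k < n → f k ≈ g k) → fold n f ≈ fold n g
  fold-cong zero    h = refl
  fold-cong (suc n) h = ∙-cong (fold-cong n λ k k<n → h k (m<n⇒m<1+n k<n)) (h n ≤-refl)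

  fold-∙ : ∀ n f g → fold n (λ k → f k ∙ g k) ≈ fold n f ∙ fold n g
  fold-∙ zero    f g = sym (identityˡ ε)
  fold-∙ (suc n) f g = trans (∙-congʳ (fold-∙ n f g)) (interchange _ _ _ _)

  fold-ε : ∀ n {f} → (∀ k → k < n → f k ≈ ε) → fold n f ≈ ε
  fold-ε zero    h = refl
  fold-ε (suc n) h =
    trans (∙-cong (fold-ε n λ k k<n → h k (m<n⇒m<1+n k<n)) (h n ≤-refl)) (identityˡ ε)

  fold-swap : ∀ m n (f : ℕ → ℕ → Carrier) →
              fold m (λ i → fold n (f i)) ≈ fold n (λ j → fold m (λ i → f i j))
  fold-swap zero    n f = sym (fold-ε n λ _ _ → refl)
  fold-swap (suc m) n f = trans (∙-congʳ (fold-swap m n f)) (sym (fold-∙ n _ _))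

  fold-+ : ∀ m n f → fold (n + m) f ≈ fold m f ∙ fold n (λ k → f (k + m))
  fold-+ m zero    f = sym (identityʳ _)
  fold-+ m (suc n) f = trans (∙-congʳ (fold-+ m n f)) (assoc _ _ _)

  fold-extend : ∀ {m n f} → m ≤ n → (∀ k → m ≤ k → f k ≈ ε) → fold n f ≈ fold m f
  fold-extend {m} {n} {f} m≤n h = begin
    fold n f                                     ≡⟨ cong (λ z → fold z f) (m∸n+n≡m m≤n) ⟨
    fold (n ∸ m + m) f                           ≈⟨ fold-+ m (n ∸ m) f ⟩
    fold m f ∙ fold (n ∸ m) (λ k → f (k + m))    ≈⟨ ∙-congˡ (fold-ε (n ∸ m) λ k _ → h (k + m) (m≤n+m m k)) ⟩
    fold m f ∙ ε                                 ≈⟨ identityʳ _ ⟩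
    fold m f                                     ∎

  fold-single : ∀ {n f} k₀ → k₀ < n → (∀ k → k < n → k ≢ k₀ → f k ≈ ε) → fold n f ≈ f k₀
  fold-single {suc n} {f} k₀ k₀<1+n h with n ≟ k₀
  ... | yes ≡.refl = trans (∙-congʳ (fold-ε n λ k k<n → h k (m<n⇒m<1+n k<n) (<⇒≢ k<n))) (identityˡ _)
  ... | no n≢k₀    = trans (∙-cong (fold-single k₀ (≤∧≢⇒< (s≤s⁻¹ k₀<1+n) (n≢k₀ ∘ ≡.sym))
                                      λ k k<n → h k (m<n⇒m<1+n k<n))
                                   (h n ≤-refl n≢k₀))
                           (identityʳ _)

  -- The range splits into `e` blocks of length `g`, and the start of a block is its only multiple
  -- of `g`.
  fold-multiples : ∀ g e {f} → 1 ≤ g → (∀ k → ¬ g ∣ k → f k ≈ ε) →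
                   fold (e * g) f ≈ fold e (λ j → f (j * g))
  fold-multiples g zero        1≤g h = refl
  fold-multiples g (suc e) {f} 1≤g h = begin
    fold (g + e * g) f                                ≈⟨ fold-+ (e * g) g f ⟩
    fold (e * g) f ∙ fold g (λ k → f (k + e * g))     ≈⟨ ∙-cong (fold-multiples g e 1≤g h) (fold-single 0 1≤g block) ⟩
    fold e (λ j → f (j * g)) ∙ f (e * g)              ∎
    where
    block : ∀ k → k < g → k ≢ 0 → f (k + e * g) ≈ ε
    block k k<g k≢0 = h (k + e * g) λ g∣ → <⇒≱ k<g
      (∣⇒≤ {{≢-nonZero k≢0}} (∣m+n∣m⇒∣n (subst (g ∣_) (+-comm k (e * g)) g∣) (n∣m*n e)))

  -- A range with unit entries in place of a list of divisors, so that ranges can be split, swapped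
  -- and extended. For `N ≥ 1` the index 0 contributes the unit.
  foldDivisors : ℕ → (ℕ → Carrier) → Carrier
  foldDivisors N f = fold (suc N) (λ d → when (d ∣? N) (f d))

  foldDivisors-range : ∀ {K N} f → 1 ≤ N → suc N ≤ K →
                       fold K (λ d → when (d ∣? N) (f d)) ≈ foldDivisors N f
  foldDivisors-range {N = N} f 1≤N N<K = fold-extend N<K
    λ k N<k → when-no (k ∣? N) (>⇒∤ {{>-nonZero 1≤N}} N<k)

  foldDivisors-split : ∀ N f →
    foldDivisors N f ≈ fold N (λ d → when (d ∣? N) (f d)) ∙ f N
  foldDivisors-split N f = ∙-congˡ (when-yes (N ∣? N) ∣-refl)

  when-swap : {P Q : Set} (d : Dec P) (e : Dec Q) {x : Carrier} →
              when d (when e x) ≈ when e (when d x)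
  when-swap (yes _) e       = refl
  when-swap (no _)  (yes _) = refl
  when-swap (no _)  (no _)  = refl

  when-split : {P : Set} (d : Dec P) (x : Carrier) → x ≈ when d x ∙ when (¬? d) x
  when-split (yes _) x = sym (identityʳ x)
  when-split (no _)  x = sym (identityˡ x)

  foldDivisors-∙ : ∀ N f g → foldDivisors N (λ d → f d ∙ g d) ≈ foldDivisors N f ∙ foldDivisors N g
  foldDivisors-∙ N f g = trans (fold-cong (suc N) λ d _ → distribute (d ∣? N)) (fold-∙ (suc N) _ _)
    where
    distribute : {P : Set} (d : Dec P) {x y : Carrier} → when d (x ∙ y) ≈ when d x ∙ when d y
    distribute (yes _) = refl
    distribute (no _)  = sym (identityˡ ε)

  -- Takes the place of Möbius inversion: by strong induction the values at proper divisors agree,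
  -- so the proper parts agree and can be cancelled. It is applied both to products in ℤ[q] and to
  -- sums in ℕ.
  foldDivisors-unique : ∀ {f g} →
    (∀ N → 1 ≤ N → ∀ x y → let P = fold N (λ d → when (d ∣? N) (g d)) in P ∙ x ≈ P ∙ y → x ≈ y) →
    (∀ N → 1 ≤ N → foldDivisors N f ≈ foldDivisors N g) → ∀ N → 1 ≤ N → f N ≈ g N
  foldDivisors-unique {f} {g} cancel h N 1≤N = below (suc N) N 1≤N ≤-refl
    where
    below : ∀ K N → 1 ≤ N → N < K → f N ≈ g N
    below (suc K) N 1≤N N<K = cancel N 1≤N (f N) (g N) (begin
      fold N (λ d → when (d ∣? N) (g d)) ∙ f N    ≈⟨ ∙-congʳ (fold-cong N same) ⟨
      fold N (λ d → when (d ∣? N) (f d)) ∙ f N    ≈⟨ foldDivisors-split N f ⟨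
      foldDivisors N f                            ≈⟨ h N 1≤N ⟩
      foldDivisors N g                            ≈⟨ foldDivisors-split N g ⟩
      fold N (λ d → when (d ∣? N) (g d)) ∙ g N    ∎)
      where
      same : ∀ d → d < N → when (d ∣? N) (f d) ≈ when (d ∣? N) (g d)
      same d d<N = when-cong (d ∣? N) (d ∣? N) id id λ d∣N →
        below K d (divisor-positive 1≤N d∣N) (<-≤-trans d<N (s≤s⁻¹ N<K))

  -- A divisor of `M * p` is either `d * p` with `d` dividing `M`, or prime to `p` and then already
  -- a divisor of `M`.
  foldDivisors-*-prime : ∀ p M f → Prime p → 1 ≤ M →
    foldDivisors (M * p) f ≈ foldDivisors M (λ d → f (d * p) ∙ when (¬? (p ∣? d)) (f d))
  foldDivisors-*-prime p M f p-prime 1≤M = begin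
    foldDivisors (M * p) f                                            ≈⟨ fold-cong (suc (M * p)) (λ k _ → when-split (p ∣? k) (F k)) ⟩
    fold (suc (M * p)) (λ k → multiple k ∙ other k)                   ≈⟨ fold-∙ (suc (M * p)) multiple other ⟩
    fold (suc (M * p)) multiple ∙ fold (suc (M * p)) other            ≈⟨ ∙-cong multiples others ⟩
    foldDivisors M (λ d → f (d * p)) ∙ foldDivisors M g               ≈⟨ foldDivisors-∙ M _ g ⟨
    foldDivisors M (λ d → f (d * p) ∙ g d)                            ∎
    where
    instance
      p≢0 : NonZero p
      p≢0 = prime⇒nonZero p-prime
    F multiple other g : ℕ → Carrier
    F k        = when (k ∣? M * p) (f k)
    multiple k = when (p ∣? k) (F k)
    other k    = when (¬? (p ∣? k)) (F k)
    g d        = when (¬? (p ∣? d)) (f d)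

    multiple-of : ∀ j → multiple (j * p) ≈ when (j ∣? M) (f (j * p))
    multiple-of j = trans (when-yes (p ∣? j * p) (n∣m*n j))
      (when-cong (j * p ∣? M * p) (j ∣? M) (*-cancelʳ-∣ p) (*-monoˡ-∣ p) (λ _ → refl))

    multiples : fold (suc (M * p)) multiple ≈ foldDivisors M (λ d → f (d * p))
    multiples = trans
      (∙-congʳ (fold-multiples p M (ℕ.>-nonZero⁻¹ p) λ k p∤k → when-no (p ∣? k) p∤k))
      (fold-cong (suc M) λ j _ → multiple-of j)

    cancel-p : ∀ {k} → ¬ p ∣ k → k ∣ M * p → k ∣ M
    cancel-p {k} p∤k k∣Mp = coprime-divisor coprime (subst (k ∣_) (*-comm M p) k∣Mp)
      where
      coprime : Coprime k p
      coprime (d∣k , d∣p) with prime⇒irreducible p-prime d∣p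
      ... | inj₁ d≡1     = d≡1
      ... | inj₂ ≡.refl  = contradiction d∣k p∤k

    others : fold (suc (M * p)) other ≈ foldDivisors M g
    others = trans
      (fold-cong (suc (M * p)) λ k _ → trans (when-swap (¬? (p ∣? k)) (k ∣? M * p)) (pointwise k))
      (foldDivisors-range g 1≤M (s≤s (m≤m*n M p)))
      where
      pointwise : ∀ k → when (k ∣? M * p) (g k) ≈ when (k ∣? M) (g k)
      pointwise k with p ∣? k
      ... | yes _  = trans (when-ε (k ∣? M * p)) (sym (when-ε (k ∣? M)))
        where
        when-ε : {P : Set} (d : Dec P) → when d ε ≈ ε
        when-ε (yes _) = refl
        when-ε (no _)  = refl
      ... | no p∤k = when-cong (k ∣? M * p) (k ∣? M) (cancel-p p∤k) (∣m⇒∣m*n p) (λ _ → refl)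

-- The divisor sum of the totient

module Sum = RangeFold +-0-commutativeMonoid

length-filter-upTo : {P : ℕ → Set} (P? : ∀ k → Dec (P k)) (n : ℕ) →
                     length (filter P? (upTo n)) ≡ Sum.fold n (λ k → Sum.when (P? k) 1)
length-filter-upTo P? zero    = ≡.refl
length-filter-upTo P? (suc n) = begin
  length (filter P? (upTo (suc n)))                            ≡⟨ cong (length ∘ filter P?) (Listₚ.upTo-∷ʳ n) ⟨
  length (filter P? (upTo n ∷ʳ n))                             ≡⟨ cong length (Listₚ.filter-++ P? (upTo n) _) ⟩
  length (filter P? (upTo n) ++ filter P? (n ∷ []))            ≡⟨ Listₚ.length-++ (filter P? (upTo n)) ⟩
  length (filter P? (upTo n)) + length (filter P? (n ∷ []))    ≡⟨ cong₂ _+_ (length-filter-upTo P? n) single ⟩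
  Sum.fold (suc n) (λ k → Sum.when (P? k) 1)                   ∎
  where
  open ≡-Reasoning
  single : length (filter P? (n ∷ [])) ≡ Sum.when (P? n) 1
  single with P? n
  ... | yes _ = ≡.refl
  ... | no  _ = ≡.refl

totient-fold : ∀ n → totient n ≡ Sum.fold n (λ k → Sum.when (gcd k n ≟ 1) 1)
totient-fold n = length-filter-upTo (λ k → gcd k n ≟ 1) n

-- Sorting 0 ≤ k < N by the quotient d = N / gcd(k, N): each class has totient d elements.
gauss : ∀ N → 1 ≤ N → Sum.foldDivisors N totient ≡ N
gauss N 1≤N = ≡.sym (begin
  N                                               ≡⟨ count-ones N ⟨
  fold N (λ _ → 1)                                ≡⟨ fold-cong N (λ k _ → one-class k) ⟩
  fold N (λ k → fold (suc N) (λ d → cell d k))    ≡⟨ fold-swap N (suc N) (λ k d → cell d k) ⟩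
  fold (suc N) (λ d → fold N (cell d))            ≡⟨ fold-cong (suc N) (λ d _ → class-size d) ⟩
  foldDivisors N totient                          ∎)
  where
  open Sum
  open ≡-Reasoning
  -- The condition d = N / gcd(k, N), written without division.
  cell : ℕ → ℕ → ℕ
  cell d k = when (d * gcd k N ≟ N) 1

  count-ones : ∀ n → fold n (λ _ → 1) ≡ n
  count-ones zero    = ≡.refl
  count-ones (suc n) = ≡.trans (+-comm _ 1) (cong suc (count-ones n))

  one-class : ∀ k → 1 ≡ fold (suc N) (λ d → cell d k)
  one-class k with gcd[m,n]∣n k N
  ... | divides q N≡q*g = ≡.sym (≡.trans
    (fold-single {f = λ d → cell d k} q (s≤s (∣⇒≤ {{>-nonZero 1≤N}} q∣N)) other)
    (when-yes (q * gcd k N ≟ N) (≡.sym N≡q*g)))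
    where
    q∣N : q ∣ N
    q∣N = subst (q ∣_) (≡.sym N≡q*g) (m∣m*n (gcd k N))
    instance
      g≢0 : NonZero (gcd k N)
      g≢0 = ≢-nonZero (gcd[m,n]≢0 k N (inj₂ (m<n⇒n≢0 1≤N)))
    other : ∀ d → d < suc N → d ≢ q → cell d k ≡ 0
    other d _ d≢q = when-no (d * gcd k N ≟ N) λ dg≡N →
      d≢q (*-cancelʳ-≡ d q (gcd k N) (≡.trans dg≡N N≡q*g))

  class-size : ∀ d → fold N (cell d) ≡ when (d ∣? N) (totient d)
  class-size d with d ∣? N
  ... | no d∤N = fold-ε N λ k _ → when-no (d * gcd k N ≟ N)
                   λ dg≡N → d∤N (subst (d ∣_) dg≡N (m∣m*n (gcd k N)))
  ... | yes (divides q N≡q*d) = begin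
    fold N (cell d)                     ≡⟨ cong (λ z → fold z (cell d)) N≡d*q ⟩
    -- With N = d q the condition reads gcd(k, N) = q, which forces k = j q; after that substitution
    -- it becomes gcd(j, d) = 1.
    fold (d * q) (cell d)               ≡⟨ fold-multiples q d 1≤q non-multiple ⟩
    fold d (λ j → cell d (j * q))       ≡⟨ fold-cong d (λ j _ → when-cong (d * gcd (j * q) N ≟ N) (gcd j d ≟ 1) (to j) (from j) (λ _ → ≡.refl)) ⟩
    fold d (λ j → when (gcd j d ≟ 1) 1) ≡⟨ totient-fold d ⟨
    totient d                           ∎
    where
    N≡d*q : N ≡ d * q
    N≡d*q = ≡.trans N≡q*d (*-comm q d)
    instance
      dq≢0 : NonZero (d * q)
      dq≢0 = >-nonZero (subst (1 ≤_) N≡d*q 1≤N)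
    d≢0 : NonZero d
    d≢0 = m*n≢0⇒m≢0 d
    q≢0 : NonZero q
    q≢0 = m*n≢0⇒n≢0 d
    1≤q : 1 ≤ q
    1≤q = ℕ.>-nonZero⁻¹ q {{q≢0}}
    gcd-scaled : ∀ j → d * gcd (j * q) N ≡ d * q * gcd j d
    gcd-scaled j = begin
      d * gcd (j * q) N          ≡⟨ cong₂ (λ a b → d * gcd a b) (*-comm j q) N≡q*d ⟩
      d * gcd (q * j) (q * d)    ≡⟨ cong (d *_) (c*gcd[m,n]≡gcd[cm,cn] q j d) ⟨
      d * (q * gcd j d)          ≡⟨ *-assoc d q _ ⟨
      d * q * gcd j d            ∎
    to : ∀ j → d * gcd (j * q) N ≡ N → gcd j d ≡ 1
    to j eq = *-cancelˡ-≡ (gcd j d) 1 (d * q)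
      (≡.trans (≡.sym (gcd-scaled j)) (≡.trans eq (≡.trans N≡d*q (≡.sym (*-identityʳ (d * q))))))
    from : ∀ j → gcd j d ≡ 1 → d * gcd (j * q) N ≡ N
    from j eq = ≡.trans (gcd-scaled j)
      (≡.trans (cong (d * q *_) eq) (≡.trans (*-identityʳ (d * q)) (≡.sym N≡d*q)))
    non-multiple : ∀ k → ¬ q ∣ k → cell d k ≡ 0
    non-multiple k q∤k = when-no (d * gcd k N ≟ N) λ dg≡N → q∤k (subst (_∣ k)
      (*-cancelˡ-≡ (gcd k N) q d {{d≢0}} (≡.trans dg≡N N≡d*q)) (gcd[m,n]∣m k N))

-- The ring ℤ[q] of coefficient lists

infix 4 _≐_

-- Lists that differ by trailing zeros denote the same polynomial. As a record, the relation lets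
-- unification recover `p` and `q`.
record _≐_ (p q : Poly) : Set where
  constructor coeffs
  field at : ∀ i → coeff i p ≡ coeff i q

open _≐_

≐-isEquivalence : IsEquivalence _≐_
≐-isEquivalence = record
  { refl  = coeffs λ _ → ≡.refl
  ; sym   = λ e → coeffs λ i → ≡.sym (at e i)
  ; trans = λ e f → coeffs λ i → ≡.trans (at e i) (at f i)
  }

open IsEquivalence ≐-isEquivalence using ()
  renaming (refl to ≐-refl; sym to ≐-sym; trans to ≐-trans)

coeff-⊕ : ∀ p q i → coeff i (p ⊕ q) ≡ coeff i p ℤ.+ coeff i q
coeff-⊕ []      q       i       = ≡.sym (ℤₚ.+-identityˡ _)
coeff-⊕ (a ∷ p) []      i       = ≡.sym (ℤₚ.+-identityʳ _)
coeff-⊕ (a ∷ p) (b ∷ q) zero    = ≡.refl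
coeff-⊕ (a ∷ p) (b ∷ q) (suc i) = coeff-⊕ p q i

coeff-scale : ∀ c p i → coeff i (scale c p) ≡ c ℤ.* coeff i p
coeff-scale c []      i       = ≡.sym (ℤₚ.*-zeroʳ c)
coeff-scale c (a ∷ p) zero    = ≡.refl
coeff-scale c (a ∷ p) (suc i) = coeff-scale c p i

coeff-⊗-zero : ∀ p q → coeff 0 (p ⊗ q) ≡ coeff 0 p ℤ.* coeff 0 q
coeff-⊗-zero []      q = ≡.refl
coeff-⊗-zero (a ∷ p) q = begin
  coeff 0 (scale a q ⊕ (+ 0 ∷ p ⊗ q))    ≡⟨ coeff-⊕ (scale a q) _ 0 ⟩
  coeff 0 (scale a q) ℤ.+ + 0            ≡⟨ ℤₚ.+-identityʳ _ ⟩
  coeff 0 (scale a q)                    ≡⟨ coeff-scale a q 0 ⟩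
  a ℤ.* coeff 0 q                        ∎
  where open ≡-Reasoning

coeff-⊗-suc : ∀ a p q i →
  coeff (suc i) ((a ∷ p) ⊗ q) ≡ a ℤ.* coeff (suc i) q ℤ.+ coeff i (p ⊗ q)
coeff-⊗-suc a p q i =
  ≡.trans (coeff-⊕ (scale a q) _ (suc i)) (cong (ℤ._+ _) (coeff-scale a q (suc i)))

∷-cong : ∀ {a b p q} → a ≡ b → p ≐ q → a ∷ p ≐ b ∷ q
∷-cong e f = coeffs λ { zero → e ; (suc i) → at f i }

⊕-cong : ∀ {p p′ q q′} → p ≐ p′ → q ≐ q′ → p ⊕ q ≐ p′ ⊕ q′
⊕-cong {p} {p′} {q} {q′} e f = coeffs λ i →
  ≡.trans (coeff-⊕ p q i) (≡.trans (cong₂ ℤ._+_ (at e i) (at f i)) (≡.sym (coeff-⊕ p′ q′ i)))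

⊕-assoc : ∀ p q r → (p ⊕ q) ⊕ r ≐ p ⊕ (q ⊕ r)
⊕-assoc p q r = coeffs λ i → begin
  coeff i ((p ⊕ q) ⊕ r)                      ≡⟨ coeff-⊕ (p ⊕ q) r i ⟩
  coeff i (p ⊕ q) ℤ.+ coeff i r              ≡⟨ cong (ℤ._+ coeff i r) (coeff-⊕ p q i) ⟩
  coeff i p ℤ.+ coeff i q ℤ.+ coeff i r      ≡⟨ ℤₚ.+-assoc (coeff i p) (coeff i q) (coeff i r) ⟩
  coeff i p ℤ.+ (coeff i q ℤ.+ coeff i r)    ≡⟨ cong (ℤ._+_ (coeff i p)) (coeff-⊕ q r i) ⟨
  coeff i p ℤ.+ coeff i (q ⊕ r)              ≡⟨ coeff-⊕ p (q ⊕ r) i ⟨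
  coeff i (p ⊕ (q ⊕ r))                      ∎
  where open ≡-Reasoning

⊕-comm : ∀ p q → p ⊕ q ≐ q ⊕ p
⊕-comm p q = coeffs λ i →
  ≡.trans (coeff-⊕ p q i) (≡.trans (ℤₚ.+-comm (coeff i p) (coeff i q)) (≡.sym (coeff-⊕ q p i)))

⊕-identityʳ : ∀ p → p ⊕ [] ≐ p
⊕-identityʳ []      = ≐-refl
⊕-identityʳ (a ∷ p) = ≐-refl

⊕-inverseʳ : ∀ p → p ⊕ scale (ℤ.- (+ 1)) p ≐ []
⊕-inverseʳ p = coeffs λ i → begin
  coeff i (p ⊕ scale ℤ.-1ℤ p)              ≡⟨ coeff-⊕ p (scale ℤ.-1ℤ p) i ⟩
  coeff i p ℤ.+ coeff i (scale ℤ.-1ℤ p)    ≡⟨ cong (ℤ._+_ (coeff i p)) (coeff-scale ℤ.-1ℤ p i) ⟩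
  coeff i p ℤ.+ ℤ.-1ℤ ℤ.* coeff i p        ≡⟨ cong (ℤ._+_ (coeff i p)) (ℤₚ.-1*i≡-i (coeff i p)) ⟩
  coeff i p ℤ.+ ℤ.- coeff i p              ≡⟨ ℤₚ.+-inverseʳ (coeff i p) ⟩
  + 0                                      ∎
  where open ≡-Reasoning

⊕-commutativeMonoid : CommutativeMonoid 0ℓ 0ℓ
⊕-commutativeMonoid = record
  { Carrier = Poly ; _≈_ = _≐_ ; _∙_ = _⊕_ ; ε = []
  ; isCommutativeMonoid = record
    { isMonoid = record
      { isSemigroup = record
        { isMagma = record { isEquivalence = ≐-isEquivalence ; ∙-cong = ⊕-cong }
        ; assoc = ⊕-assoc }
      ; identity = (λ _ → ≐-refl) , ⊕-identityʳ }
    ; comm = ⊕-comm } }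

module ≐-Reasoning = SetoidReasoning (CommutativeMonoid.setoid ⊕-commutativeMonoid)
open CSProperties (CommutativeMonoid.commutativeSemigroup ⊕-commutativeMonoid) using ()
  renaming (interchange to ⊕-interchange; x∙yz≈y∙xz to ⊕-left-comm)

scale-cong : ∀ c {p q} → p ≐ q → scale c p ≐ scale c q
scale-cong c {p} {q} e = coeffs λ i →
  ≡.trans (coeff-scale c p i) (≡.trans (cong (c ℤ.*_) (at e i)) (≡.sym (coeff-scale c q i)))

scale-⊕ : ∀ c p q → scale c (p ⊕ q) ≐ scale c p ⊕ scale c q
scale-⊕ c p q = coeffs λ i → begin
  coeff i (scale c (p ⊕ q))                       ≡⟨ coeff-scale c (p ⊕ q) i ⟩
  c ℤ.* coeff i (p ⊕ q)                           ≡⟨ cong (c ℤ.*_) (coeff-⊕ p q i) ⟩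
  c ℤ.* (coeff i p ℤ.+ coeff i q)                 ≡⟨ ℤₚ.*-distribˡ-+ c (coeff i p) (coeff i q) ⟩
  c ℤ.* coeff i p ℤ.+ c ℤ.* coeff i q             ≡⟨ cong₂ ℤ._+_ (coeff-scale c p i) (coeff-scale c q i) ⟨
  coeff i (scale c p) ℤ.+ coeff i (scale c q)     ≡⟨ coeff-⊕ (scale c p) (scale c q) i ⟨
  coeff i (scale c p ⊕ scale c q)                 ∎
  where open ≡-Reasoning

scale-scale : ∀ c d p → scale c (scale d p) ≐ scale (c ℤ.* d) p
scale-scale c d p = coeffs λ i → begin
  coeff i (scale c (scale d p))    ≡⟨ coeff-scale c (scale d p) i ⟩
  c ℤ.* coeff i (scale d p)        ≡⟨ cong (c ℤ.*_) (coeff-scale d p i) ⟩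
  c ℤ.* (d ℤ.* coeff i p)          ≡⟨ ℤₚ.*-assoc c d (coeff i p) ⟨
  c ℤ.* d ℤ.* coeff i p            ≡⟨ coeff-scale (c ℤ.* d) p i ⟨
  coeff i (scale (c ℤ.* d) p)      ∎
  where open ≡-Reasoning

scale-∷ : ∀ c p → scale c (+ 0 ∷ p) ≐ + 0 ∷ scale c p
scale-∷ c p = ∷-cong (ℤₚ.*-zeroʳ c) ≐-refl

scale-zero : ∀ p → scale (+ 0) p ≐ []
scale-zero p = coeffs (coeff-scale (+ 0) p)

scale-one : ∀ p → scale (+ 1) p ≐ p
scale-one p = coeffs λ i → ≡.trans (coeff-scale (+ 1) p i) (ℤₚ.*-identityˡ _)

0∷[]≐[] : + 0 ∷ [] ≐ []
0∷[]≐[] = coeffs λ { zero → ≡.refl ; (suc _) → ≡.refl }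

⊗-congˡ : ∀ p {q q′} → q ≐ q′ → p ⊗ q ≐ p ⊗ q′
⊗-congˡ []      e = ≐-refl
⊗-congˡ (a ∷ p) e = ⊕-cong (scale-cong a e) (∷-cong ≡.refl (⊗-congˡ p e))

⊗-zeroʳ : ∀ p → p ⊗ [] ≐ []
⊗-zeroʳ []      = ≐-refl
⊗-zeroʳ (a ∷ p) = ≐-trans (∷-cong ≡.refl (⊗-zeroʳ p)) 0∷[]≐[]

-- The defining recursion of `⊗` transposed to the right factor; commutativity follows by comparing
-- the two recursions.
⊗-∷ : ∀ p b q → p ⊗ (b ∷ q) ≐ scale b p ⊕ (+ 0 ∷ p ⊗ q)
⊗-∷ []      b q = ≐-sym 0∷[]≐[]
⊗-∷ (a ∷ p) b q = ∷-cong (cong (ℤ._+ + 0) (ℤₚ.*-comm a b)) (begin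
  scale a q ⊕ p ⊗ (b ∷ q)                        ≈⟨ ⊕-cong ≐-refl (⊗-∷ p b q) ⟩
  scale a q ⊕ (scale b p ⊕ (+ 0 ∷ p ⊗ q))        ≈⟨ ⊕-left-comm (scale a q) (scale b p) _ ⟩
  scale b p ⊕ (scale a q ⊕ (+ 0 ∷ p ⊗ q))        ∎)
  where open ≐-Reasoning

⊗-comm : ∀ p q → p ⊗ q ≐ q ⊗ p
⊗-comm []      q = ≐-sym (⊗-zeroʳ q)
⊗-comm (a ∷ p) q = ≐-trans (⊕-cong ≐-refl (∷-cong ≡.refl (⊗-comm p q))) (≐-sym (⊗-∷ q a p))

⊗-congʳ : ∀ {p p′} q → p ≐ p′ → p ⊗ q ≐ p′ ⊗ q
⊗-congʳ {p} {p′} q e = ≐-trans (⊗-comm p q) (≐-trans (⊗-congˡ q e) (⊗-comm q p′))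

⊗-cong : ∀ {p p′ q q′} → p ≐ p′ → q ≐ q′ → p ⊗ q ≐ p′ ⊗ q′
⊗-cong {p′ = p′} {q} e f = ≐-trans (⊗-congʳ q e) (⊗-congˡ p′ f)

⊗-distribˡ : ∀ p q r → p ⊗ (q ⊕ r) ≐ p ⊗ q ⊕ p ⊗ r
⊗-distribˡ []      q r = ≐-refl
⊗-distribˡ (a ∷ p) q r = ≐-trans
  (⊕-cong (scale-⊕ a q r) (∷-cong ≡.refl (⊗-distribˡ p q r)))
  (⊕-interchange (scale a q) (scale a r) (+ 0 ∷ p ⊗ q) (+ 0 ∷ p ⊗ r))

⊗-distribʳ : ∀ p q r → (q ⊕ r) ⊗ p ≐ q ⊗ p ⊕ r ⊗ p
⊗-distribʳ p q r = ≐-trans (⊗-comm (q ⊕ r) p)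
  (≐-trans (⊗-distribˡ p q r) (⊕-cong (⊗-comm p q) (⊗-comm p r)))

scale-⊗ : ∀ c p q → scale c p ⊗ q ≐ scale c (p ⊗ q)
scale-⊗ c []      q = ≐-refl
scale-⊗ c (a ∷ p) q = begin
  scale (c ℤ.* a) q ⊕ (+ 0 ∷ scale c p ⊗ q)           ≈⟨ ⊕-cong (≐-sym (scale-scale c a q)) (∷-cong ≡.refl (scale-⊗ c p q)) ⟩
  scale c (scale a q) ⊕ (+ 0 ∷ scale c (p ⊗ q))       ≈⟨ ⊕-cong ≐-refl (scale-∷ c (p ⊗ q)) ⟨
  scale c (scale a q) ⊕ scale c (+ 0 ∷ p ⊗ q)         ≈⟨ scale-⊕ c (scale a q) _ ⟨
  scale c (scale a q ⊕ (+ 0 ∷ p ⊗ q))                 ∎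
  where open ≐-Reasoning

0∷-⊗ : ∀ p q → (+ 0 ∷ p) ⊗ q ≐ + 0 ∷ p ⊗ q
0∷-⊗ p q = ⊕-cong (scale-zero q) ≐-refl

⊗-assoc : ∀ p q r → (p ⊗ q) ⊗ r ≐ p ⊗ (q ⊗ r)
⊗-assoc []      q r = ≐-refl
⊗-assoc (a ∷ p) q r = begin
  (scale a q ⊕ (+ 0 ∷ p ⊗ q)) ⊗ r            ≈⟨ ⊗-distribʳ r (scale a q) _ ⟩
  scale a q ⊗ r ⊕ (+ 0 ∷ p ⊗ q) ⊗ r          ≈⟨ ⊕-cong (scale-⊗ a q r) (0∷-⊗ (p ⊗ q) r) ⟩
  scale a (q ⊗ r) ⊕ (+ 0 ∷ (p ⊗ q) ⊗ r)      ≈⟨ ⊕-cong ≐-refl (∷-cong ≡.refl (⊗-assoc p q r)) ⟩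
  scale a (q ⊗ r) ⊕ (+ 0 ∷ p ⊗ (q ⊗ r))      ∎
  where open ≐-Reasoning

constant : ℤ → Poly
constant c = c ∷ []

constant-⊗ : ∀ c p → constant c ⊗ p ≐ scale c p
constant-⊗ c p = ≐-trans (⊕-cong ≐-refl 0∷[]≐[]) (⊕-identityʳ (scale c p))

⊗-identityˡ : ∀ p → constant (+ 1) ⊗ p ≐ p
⊗-identityˡ p = ≐-trans (constant-⊗ (+ 1) p) (scale-one p)

polyRing : CommutativeRing 0ℓ 0ℓ
polyRing = record
  { Carrier = Poly ; _≈_ = _≐_ ; _+_ = _⊕_ ; _*_ = _⊗_
  ; -_ = scale (ℤ.- (+ 1)) ; 0# = [] ; 1# = constant (+ 1)
  ; isCommutativeRing = record
    { isRing = record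
      { +-isAbelianGroup = record
        { isGroup = record
          { isMonoid = CommutativeMonoid.isMonoid ⊕-commutativeMonoid
          ; inverse = (λ p → ≐-trans (⊕-comm _ p) (⊕-inverseʳ p)) , ⊕-inverseʳ
          ; ⁻¹-cong = scale-cong (ℤ.- (+ 1)) }
        ; comm = ⊕-comm }
      ; *-cong = ⊗-cong
      ; *-assoc = ⊗-assoc
      ; *-identity = ⊗-identityˡ , λ p → ≐-trans (⊗-comm p _) (⊗-identityˡ p)
      ; distrib = ⊗-distribˡ , ⊗-distribʳ }
    ; *-comm = ⊗-comm } }

-- Homogenization

module RingNotation {c ℓ} (R : CommutativeRing c ℓ) where
  open CommutativeRing R public
    using (Carrier; _≈_; 0#; 1#; refl; sym; trans; reflexive; setoid; commutativeSemiring)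
    renaming ( _+_ to _⊞_; _*_ to _·_; -_ to ⊟_
             ; +-cong to ⊞-cong; +-congˡ to ⊞-congˡ; +-congʳ to ⊞-congʳ
             ; *-cong to ·-cong; *-congˡ to ·-congˡ; *-congʳ to ·-congʳ; -‿cong to ⊟-cong
             ; +-assoc to ⊞-assoc; +-comm to ⊞-comm
             ; +-identityˡ to ⊞-identityˡ; +-identityʳ to ⊞-identityʳ
             ; *-assoc to ·-assoc; *-comm to ·-comm
             ; *-identityˡ to ·-identityˡ; *-identityʳ to ·-identityʳ
             ; distribʳ to ·-distribʳ
             ; zeroˡ to ·-zeroˡ; zeroʳ to ·-zeroʳ
             ; -‿inverseˡ to ⊟-inverseˡ; -‿inverseʳ to ⊟-inverseʳ )
  open RingProperties (CommutativeRing.ring R) public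
    using ()
    renaming ( -‿involutive to ⊟-involutive; -‿+-comm to ⊟-⊞-comm; -0#≈0# to ⊟0≈0
             ; -‿distribˡ-* to ⊟-distribˡ-·
             ; +-cancelˡ to ⊞-cancelˡ )
  module ≈-Reasoning = SetoidReasoning setoid
  module Solver = NatCoeffSolver commutativeSemiring

  infixr 8 _^^_
  _^^_ : Carrier → ℕ → Carrier
  x ^^ k = powR R x k

  ⟦_⟧ : ℤ → Carrier
  ⟦ z ⟧ = fromℤR R z

module RingPowers {c ℓ} (R : CommutativeRing c ℓ) where
  open RingNotation R
  open Solver using (solve; _:=_; _:+_; _:*_)

  ^^-cong : ∀ {x y} k → x ≈ y → x ^^ k ≈ y ^^ k
  ^^-cong zero    e = refl
  ^^-cong (suc k) e = ·-cong e (^^-cong k e)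

  ^^-+ : ∀ x m n → x ^^ (m + n) ≈ x ^^ m · x ^^ n
  ^^-+ x zero    n = sym (·-identityˡ _)
  ^^-+ x (suc m) n = trans (·-congˡ (^^-+ x m n)) (sym (·-assoc _ _ _))

  ^^-* : ∀ x m n → x ^^ (m * n) ≈ (x ^^ n) ^^ m
  ^^-* x zero    n = refl
  ^^-* x (suc m) n = trans (^^-+ x n (m * n)) (·-congˡ (^^-* x m n))

  ·-^^ : ∀ x y k → (x · y) ^^ k ≈ x ^^ k · y ^^ k
  ·-^^ x y zero    = sym (·-identityˡ _)
  ·-^^ x y (suc k) = trans (·-congˡ (·-^^ x y k))
    (solve 4 (λ x y a b → (x :* y) :* (a :* b) := (x :* a) :* (y :* b)) refl x y _ _)

  1^^ : ∀ k → 1# ^^ k ≈ 1#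
  1^^ zero    = refl
  1^^ (suc k) = trans (·-identityˡ _) (1^^ k)

module IntegerImage {c ℓ} (R : CommutativeRing c ℓ) where
  open RingNotation R
  open ≈-Reasoning
  open Solver using (solve; _:=_; _:+_; _:*_)

  fromℕR-+ : ∀ m n → fromℕR R (m + n) ≈ fromℕR R m ⊞ fromℕR R n
  fromℕR-+ zero    n = sym (⊞-identityˡ _)
  fromℕR-+ (suc m) n = trans (⊞-congˡ (fromℕR-+ m n)) (sym (⊞-assoc _ _ _))

  fromℤR-⊖ : ∀ m n → ⟦ m ℤ.⊖ n ⟧ ≈ fromℕR R m ⊞ ⊟ fromℕR R n
  fromℤR-⊖ zero    zero    = sym (⊟-inverseʳ _)
  fromℤR-⊖ zero    (suc n) = sym (⊞-identityˡ _)
  fromℤR-⊖ (suc m) zero    = sym (trans (⊞-congˡ ⊟0≈0) (⊞-identityʳ _))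
  fromℤR-⊖ (suc m) (suc n) = begin
    ⟦ suc m ℤ.⊖ suc n ⟧                      ≡⟨ cong ⟦_⟧ (ℤₚ.[1+m]⊖[1+n]≡m⊖n m n) ⟩
    ⟦ m ℤ.⊖ n ⟧                              ≈⟨ fromℤR-⊖ m n ⟩
    M ⊞ ⊟ N                                  ≈⟨ ⊞-identityˡ _ ⟨
    0# ⊞ (M ⊞ ⊟ N)                           ≈⟨ ⊞-congʳ (⊟-inverseʳ 1#) ⟨
    (1# ⊞ ⊟ 1#) ⊞ (M ⊞ ⊟ N)                  ≈⟨ solve 4 (λ a b c d → (a :+ b) :+ (c :+ d) := (a :+ c) :+ (b :+ d)) refl 1# (⊟ 1#) M (⊟ N) ⟩
    (1# ⊞ M) ⊞ (⊟ 1# ⊞ ⊟ N)                  ≈⟨ ⊞-congˡ (⊟-⊞-comm 1# N) ⟩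
    (1# ⊞ M) ⊞ ⊟ (1# ⊞ N)                    ∎
    where
    M = fromℕR R m
    N = fromℕR R n

  fromℤR-+ : ∀ i j → ⟦ i ℤ.+ j ⟧ ≈ ⟦ i ⟧ ⊞ ⟦ j ⟧
  fromℤR-+ (+ m)    (+ n)    = fromℕR-+ m n
  fromℤR-+ (+ m)    -[1+ n ] = fromℤR-⊖ m (suc n)
  fromℤR-+ -[1+ m ] (+ n)    = trans (fromℤR-⊖ n (suc m)) (⊞-comm _ _)
  fromℤR-+ -[1+ m ] -[1+ n ] = begin
    ⊟ fromℕR R (suc (suc (m + n)))              ≡⟨ cong (λ k → ⊟ fromℕR R (suc k)) (+-suc m n) ⟨
    ⊟ fromℕR R (suc m + suc n)                  ≈⟨ ⊟-cong (fromℕR-+ (suc m) (suc n)) ⟩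
    ⊟ (fromℕR R (suc m) ⊞ fromℕR R (suc n))     ≈⟨ ⊟-⊞-comm _ _ ⟨
    ⊟ fromℕR R (suc m) ⊞ ⊟ fromℕR R (suc n)     ∎

  fromℤR-neg : ∀ i → ⟦ ℤ.- i ⟧ ≈ ⊟ ⟦ i ⟧
  fromℤR-neg (+ zero)    = sym ⊟0≈0
  fromℤR-neg (+ (suc n)) = refl
  fromℤR-neg -[1+ n ]    = sym (⊟-involutive _)

  fromℤR-one : ⟦ + 1 ⟧ ≈ 1#
  fromℤR-one = ⊞-identityʳ 1#

  fromℤR-ℕ* : ∀ m j → ⟦ + m ℤ.* j ⟧ ≈ fromℕR R m · ⟦ j ⟧
  fromℤR-ℕ* zero    j = sym (·-zeroˡ _)
  fromℤR-ℕ* (suc m) j = begin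
    ⟦ (+ 1 ℤ.+ + m) ℤ.* j ⟧                 ≡⟨ cong ⟦_⟧ (ℤₚ.*-distribʳ-+ j (+ 1) (+ m)) ⟩
    ⟦ + 1 ℤ.* j ℤ.+ + m ℤ.* j ⟧             ≈⟨ fromℤR-+ (+ 1 ℤ.* j) (+ m ℤ.* j) ⟩
    ⟦ + 1 ℤ.* j ⟧ ⊞ ⟦ + m ℤ.* j ⟧           ≈⟨ ⊞-cong (trans (reflexive (cong ⟦_⟧ (ℤₚ.*-identityˡ j))) (sym (·-identityˡ _))) (fromℤR-ℕ* m j) ⟩
    1# · ⟦ j ⟧ ⊞ fromℕR R m · ⟦ j ⟧         ≈⟨ ·-distribʳ _ _ _ ⟨
    fromℕR R (suc m) · ⟦ j ⟧                ∎

  fromℤR-* : ∀ i j → ⟦ i ℤ.* j ⟧ ≈ ⟦ i ⟧ · ⟦ j ⟧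
  fromℤR-* (+ m)    j = fromℤR-ℕ* m j
  fromℤR-* -[1+ m ] j = begin
    ⟦ -[1+ m ] ℤ.* j ⟧               ≡⟨ cong ⟦_⟧ (ℤₚ.neg-distribˡ-* (+ (suc m)) j) ⟨
    ⟦ ℤ.- (+ (suc m) ℤ.* j) ⟧        ≈⟨ fromℤR-neg (+ (suc m) ℤ.* j) ⟩
    ⊟ ⟦ + (suc m) ℤ.* j ⟧            ≈⟨ ⊟-cong (fromℤR-ℕ* (suc m) j) ⟩
    ⊟ (fromℕR R (suc m) · ⟦ j ⟧)     ≈⟨ ⊟-distribˡ-· _ _ ⟩
    ⊟ fromℕR R (suc m) · ⟦ j ⟧       ∎

-- Degree bounds

Bound : ℕ → Poly → Set
Bound n p = ∀ i → n < i → coeff i p ≡ + 0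

Bound-resp : ∀ {n p q} → p ≐ q → Bound n p → Bound n q
Bound-resp e b i n<i = ≡.trans (≡.sym (at e i)) (b i n<i)

Bound-mono : ∀ {m n p} → m ≤ n → Bound m p → Bound n p
Bound-mono m≤n b i n<i = b i (≤-<-trans m≤n n<i)

Bound-⊕ : ∀ {n} p q → Bound n p → Bound n q → Bound n (p ⊕ q)
Bound-⊕ p q b b′ i n<i = ≡.trans (coeff-⊕ p q i) (cong₂ ℤ._+_ (b i n<i) (b′ i n<i))

Bound-scale : ∀ {n} c p → Bound n p → Bound n (scale c p)
Bound-scale c p b i n<i =
  ≡.trans (coeff-scale c p i) (≡.trans (cong (c ℤ.*_) (b i n<i)) (ℤₚ.*-zeroʳ c))

Bound-tail : ∀ {n a p} → Bound (suc n) (a ∷ p) → Bound n p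
Bound-tail b i n<i = b (suc i) (s≤s n<i)

Bound-zero : ∀ {a p} → Bound 0 (a ∷ p) → a ∷ p ≐ constant a
Bound-zero b = coeffs λ { zero → ≡.refl ; (suc i) → b (suc i) (s≤s z≤n) }

Bound-length : ∀ {n} p → length p ≤ suc n → Bound n p
Bound-length []                _         i       _         = ≡.refl
Bound-length (a ∷ p)           (s≤s l)   (suc i) n<i       = helper p l i (s≤s⁻¹ n<i)
  where
  helper : ∀ {n} p → length p ≤ n → ∀ i → n ≤ i → coeff i p ≡ + 0
  helper []      _       i       _   = ≡.refl
  helper (a ∷ p) (s≤s l) (suc i) n≤i = helper p l i (s≤s⁻¹ n≤i)

Bound-shift : ∀ {n} k p → Bound n p → Bound (k + n) (shift k p)
Bound-shift zero    p b = b
Bound-shift (suc k) p b = λ { (suc i) k+n<i → Bound-shift k p b i (s≤s⁻¹ k+n<i) }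

Bound-⊗ : ∀ n m p q → Bound n p → Bound m q → Bound (n + m) (p ⊗ q)
Bound-⊗ n       m []      q b b′ i       _   = ≡.refl
Bound-⊗ zero    m (a ∷ p) q b b′ =
  Bound-resp (≐-sym (≐-trans (⊗-congʳ q (Bound-zero b)) (constant-⊗ a q))) (Bound-scale a q b′)
Bound-⊗ (suc n) m (a ∷ p) q b b′ (suc i) n+m<i = ≡.trans (coeff-⊗-suc a p q i)
  (cong₂ ℤ._+_
    (≡.trans (cong (a ℤ.*_) (b′ (suc i) (≤-<-trans (m≤n+m m (suc n)) n+m<i))) (ℤₚ.*-zeroʳ a))
    (Bound-⊗ n m p q (Bound-tail b) b′ i (s≤s⁻¹ n+m<i)))

coeff-⊗-top : ∀ n m p q → Bound n p → Bound m q →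
              coeff (n + m) (p ⊗ q) ≡ coeff n p ℤ.* coeff m q
coeff-⊗-top n       m []      q b b′ = ≡.refl
coeff-⊗-top zero    m (a ∷ p) q b b′ =
  ≡.trans (at (≐-trans (⊗-congʳ q (Bound-zero b)) (constant-⊗ a q)) m) (coeff-scale a q m)
coeff-⊗-top (suc n) m (a ∷ p) q b b′ = ≡.trans (coeff-⊗-suc a p q (n + m))
  (≡.trans (cong₂ ℤ._+_
    (≡.trans (cong (a ℤ.*_) (b′ (suc n + m) (s≤s (m≤n+m m n)))) (ℤₚ.*-zeroʳ a))
    (coeff-⊗-top n m p q (Bound-tail b) b′)) (ℤₚ.+-identityˡ _))

Bound-ppow-onePlusQ : ∀ k → Bound k (ppow onePlusQ k)
Bound-ppow-onePlusQ zero    = Bound-length (constant (+ 1)) ≤-refl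
Bound-ppow-onePlusQ (suc k) =
  Bound-⊗ 1 k onePlusQ (ppow onePlusQ k) (Bound-length onePlusQ ≤-refl) (Bound-ppow-onePlusQ k)

-- homog n p is Yⁿ p(X / Y), for p of degree at most n. Reversal of coefficients is the
-- case X = 1, Y = q, and the substitution q ↦ qᵏ is the case X = qᵏ, Y = 1.
module Homogenization {c ℓ} (R : CommutativeRing c ℓ) (X Y : CommutativeRing.Carrier R) where
  open RingNotation R
  open RingPowers R
  open IntegerImage R
  open ≈-Reasoning
  open Solver using (solve; _:=_; _:+_; _:*_)

  -- Horner's scheme for the sum of f(i) X^i Y^(n - i) over i ≤ n. Taking a coefficient function
  -- instead of a list makes the value independent of trailing zeros.
  homogSeq : ℕ → (ℕ → ℤ) → Carrier
  homogSeq zero    f = ⟦ f 0 ⟧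
  homogSeq (suc n) f = ⟦ f 0 ⟧ · Y ^^ suc n ⊞ X · homogSeq n (f ∘ suc)

  homogSeq-cong : ∀ n {f g} → (∀ i → f i ≡ g i) → homogSeq n f ≈ homogSeq n g
  homogSeq-cong zero    h = reflexive (cong ⟦_⟧ (h 0))
  homogSeq-cong (suc n) h =
    ⊞-cong (·-congʳ (reflexive (cong ⟦_⟧ (h 0)))) (·-congˡ (homogSeq-cong n (h ∘ suc)))

  homogSeq-+ : ∀ n f g → homogSeq n (λ i → f i ℤ.+ g i) ≈ homogSeq n f ⊞ homogSeq n g
  homogSeq-+ zero    f g = fromℤR-+ (f 0) (g 0)
  homogSeq-+ (suc n) f g = trans
    (⊞-cong (·-congʳ (fromℤR-+ (f 0) (g 0))) (·-congˡ (homogSeq-+ n (f ∘ suc) (g ∘ suc))))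
    (solve 6 (λ a b y x c d → (a :+ b) :* y :+ x :* (c :+ d) := (a :* y :+ x :* c) :+ (b :* y :+ x :* d))
      refl _ _ _ X _ _)

  homogSeq-scale : ∀ n c f → homogSeq n (λ i → c ℤ.* f i) ≈ ⟦ c ⟧ · homogSeq n f
  homogSeq-scale zero    c f = fromℤR-* c (f 0)
  homogSeq-scale (suc n) c f = trans
    (⊞-cong (·-congʳ (fromℤR-* c (f 0))) (·-congˡ (homogSeq-scale n c (f ∘ suc))))
    (solve 5 (λ c a y x d → (c :* a) :* y :+ x :* (c :* d) := c :* (a :* y :+ x :* d))
      refl ⟦ c ⟧ _ _ X _)

  homogSeq-zero : ∀ n {f} → (∀ i → f i ≡ + 0) → homogSeq n f ≈ 0#
  homogSeq-zero zero    h = reflexive (cong ⟦_⟧ (h 0))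
  homogSeq-zero (suc n) h = trans
    (⊞-cong (trans (·-congʳ (reflexive (cong ⟦_⟧ (h 0)))) (·-zeroˡ _))
            (trans (·-congˡ (homogSeq-zero n (h ∘ suc))) (·-zeroʳ _)))
    (⊞-identityˡ _)

  -- Raising the nominal degree by `k` multiplies each term by `Y ^^ k`; the terms that are new have
  -- coefficient zero.
  homogSeq-degree : ∀ n k {f} → (∀ i → n < i → f i ≡ + 0) →
                    homogSeq (n + k) f ≈ Y ^^ k · homogSeq n f
  homogSeq-degree zero    zero    h = sym (·-identityˡ _)
  homogSeq-degree zero    (suc k) h = trans
    (⊞-congˡ (trans (·-congˡ (homogSeq-zero k λ i → h (suc i) (s≤s z≤n))) (·-zeroʳ X)))
    (trans (⊞-identityʳ _) (·-comm _ _))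
  homogSeq-degree (suc n) k       h = trans
    (⊞-cong (·-congˡ (^^-+ Y (suc n) k)) (·-congˡ (homogSeq-degree n k λ i n<i → h (suc i) (s≤s n<i))))
    (solve 5 (λ a y z x b → a :* (y :* z) :+ x :* (z :* b) := z :* (a :* y :+ x :* b)) refl _ _ _ X _)

  homog : ℕ → Poly → Carrier
  homog n p = homogSeq n (λ i → coeff i p)

  homog-cong : ∀ n {p q} → p ≐ q → homog n p ≈ homog n q
  homog-cong n e = homogSeq-cong n (at e)

  homog-⊕ : ∀ n p q → homog n (p ⊕ q) ≈ homog n p ⊞ homog n q
  homog-⊕ n p q = trans (homogSeq-cong n (coeff-⊕ p q)) (homogSeq-+ n _ _)

  homog-scale : ∀ n c p → homog n (scale c p) ≈ ⟦ c ⟧ · homog n p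
  homog-scale n c p = trans (homogSeq-cong n (coeff-scale c p)) (homogSeq-scale n c _)

  homog-degree : ∀ n k p → Bound n p → homog (n + k) p ≈ Y ^^ k · homog n p
  homog-degree n k p b = homogSeq-degree n k b

  homog-0∷ : ∀ n p → homog (suc n) (+ 0 ∷ p) ≈ X · homog n p
  homog-0∷ n p = trans (⊞-congʳ (·-zeroˡ _)) (⊞-identityˡ _)

  homog-⊗ : ∀ n m p q → Bound n p → Bound m q → homog (n + m) (p ⊗ q) ≈ homog n p · homog m q
  homog-⊗ n       m []      q b b′ = begin
    homog (n + m) []         ≈⟨ homogSeq-zero (n + m) (λ _ → ≡.refl) ⟩
    0#                       ≈⟨ ·-zeroˡ _ ⟨
    0# · homog m q           ≈⟨ ·-congʳ (homogSeq-zero n (λ _ → ≡.refl)) ⟨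
    homog n [] · homog m q   ∎
  homog-⊗ zero    m (a ∷ p) q b b′ = begin
    homog m ((a ∷ p) ⊗ q)    ≈⟨ homog-cong m (≐-trans (⊗-congʳ q (Bound-zero b)) (constant-⊗ a q)) ⟩
    homog m (scale a q)      ≈⟨ homog-scale m a q ⟩
    ⟦ a ⟧ · homog m q        ∎
  homog-⊗ (suc n) m (a ∷ p) q b b′ = begin
    homog (suc n + m) (scale a q ⊕ (+ 0 ∷ p ⊗ q))
      ≈⟨ homog-⊕ (suc n + m) (scale a q) _ ⟩
    homog (suc n + m) (scale a q) ⊞ homog (suc n + m) (+ 0 ∷ p ⊗ q)
      ≈⟨ ⊞-cong (homog-scale (suc n + m) a q) (homog-0∷ (n + m) (p ⊗ q)) ⟩
    ⟦ a ⟧ · homog (suc n + m) q ⊞ X · homog (n + m) (p ⊗ q)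
      -- Here `q` of degree `m` is homogenized in degree `suc n + m`. The excess yields the factor
      -- `Y ^^ suc n` that accompanies `⟦ a ⟧` in the homogenization of `a ∷ p`.
      ≈⟨ ⊞-cong (·-congˡ (trans (reflexive (cong (λ k → homog k q) (+-comm (suc n) m))) (homog-degree m (suc n) q b′)))
                (·-congˡ (homog-⊗ n m p q (Bound-tail b) b′)) ⟩
    ⟦ a ⟧ · (Y ^^ suc n · homog m q) ⊞ X · (homog n p · homog m q)
      ≈⟨ solve 5 (λ a y x b d → a :* (y :* d) :+ x :* (b :* d) := (a :* y :+ x :* b) :* d) refl _ _ X _ _ ⟩
    (⟦ a ⟧ · Y ^^ suc n ⊞ X · homog n p) · homog m q
      ∎

  homog-constant : ∀ n c → homog n (constant c) ≈ ⟦ c ⟧ · Y ^^ n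
  homog-constant n c =
    trans (homog-degree 0 n (constant c) (Bound-length (constant c) ≤-refl)) (·-comm _ _)

  homog-shift : ∀ k n p → homog (k + n) (shift k p) ≈ X ^^ k · homog n p
  homog-shift zero    n p = sym (·-identityˡ _)
  homog-shift (suc k) n p = trans (homog-0∷ (k + n) (shift k p))
    (trans (·-congˡ (homog-shift k n p)) (sym (·-assoc _ _ _)))

  homog-monomial : ∀ k → homog k (shift k (constant (+ 1))) ≈ X ^^ k
  homog-monomial k = begin
    homog k (shift k (constant (+ 1)))          ≡⟨ cong (λ i → homog i (shift k (constant (+ 1)))) (+-identityʳ k) ⟨
    homog (k + 0) (shift k (constant (+ 1)))    ≈⟨ homog-shift k 0 (constant (+ 1)) ⟩
    X ^^ k · ⟦ + 1 ⟧                            ≈⟨ ·-congˡ fromℤR-one ⟩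
    X ^^ k · 1#                                 ≈⟨ ·-identityʳ _ ⟩
    X ^^ k                                      ∎

  homog-onePlusQ : homog 1 onePlusQ ≈ X ⊞ Y
  homog-onePlusQ = begin
    ⟦ + 1 ⟧ · (Y · 1#) ⊞ X · ⟦ + 1 ⟧    ≈⟨ ⊞-cong (·-cong fromℤR-one (·-identityʳ Y)) (·-congˡ fromℤR-one) ⟩
    1# · Y ⊞ X · 1#                     ≈⟨ ⊞-cong (·-identityˡ Y) (·-identityʳ X) ⟩
    Y ⊞ X                               ≈⟨ ⊞-comm Y X ⟩
    X ⊞ Y                               ∎

  homog-onePlusQ^ : ∀ k → homog k (ppow onePlusQ k) ≈ (X ⊞ Y) ^^ k
  homog-onePlusQ^ zero    = fromℤR-one
  homog-onePlusQ^ (suc k) = trans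
    (homog-⊗ 1 k onePlusQ (ppow onePlusQ k) (Bound-length onePlusQ ≤-refl) (Bound-ppow-onePlusQ k))
    (·-cong homog-onePlusQ (homog-onePlusQ^ k))

-- Cancellation and exact division in ℤ[q]

fromℕR-poly : ∀ n → fromℕR polyRing n ≐ constant (+ n)
fromℕR-poly zero    = ≐-sym 0∷[]≐[]
fromℕR-poly (suc n) = ⊕-cong ≐-refl (fromℕR-poly n)

fromℤR-poly : ∀ z → fromℤR polyRing z ≐ constant z
fromℤR-poly (+ n)    = fromℕR-poly n
fromℤR-poly -[1+ n ] = ≐-trans (scale-cong (ℤ.- (+ 1)) (fromℕR-poly (suc n)))
  (∷-cong (ℤₚ.-1*i≡-i (+ (suc n))) ≐-refl)

module Poly-Notation = RingNotation polyRing
open Poly-Notation using () renaming (_^^_ to _^ᵖ_; ⊟_ to ⊖_)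
module Poly-Powers = RingPowers polyRing

X : Poly
X = + 0 ∷ + 1 ∷ []

X-⊗ : ∀ p → X ⊗ p ≐ + 0 ∷ p
X-⊗ p = ≐-trans (0∷-⊗ (constant (+ 1)) p) (∷-cong ≡.refl (⊗-identityˡ p))

shift-X : ∀ k p → shift k p ≐ X ^ᵖ k ⊗ p
shift-X zero    p = ≐-sym (⊗-identityˡ p)
shift-X (suc k) p = begin
  + 0 ∷ shift k p        ≈⟨ ∷-cong ≡.refl (shift-X k p) ⟩
  + 0 ∷ X ^ᵖ k ⊗ p       ≈⟨ X-⊗ _ ⟨
  X ⊗ (X ^ᵖ k ⊗ p)       ≈⟨ ⊗-assoc X (X ^ᵖ k) p ⟨
  X ^ᵖ suc k ⊗ p         ∎
  where open ≐-Reasoning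

-- The lowest coefficient of `p` times that of `d` is zero in the domain ℤ, hence it vanishes; the
-- same applies to the tail of `p`.
⊗-annihilate : ∀ {d} → coeff 0 d ≢ + 0 → ∀ p → p ⊗ d ≐ [] → p ≐ []
⊗-annihilate     d₀≢0 []      e = ≐-refl
⊗-annihilate {d} d₀≢0 (a ∷ p) e = ≐-trans (∷-cong a≡0 (⊗-annihilate d₀≢0 p tail)) 0∷[]≐[]
  where
  a≡0 : a ≡ + 0
  a≡0 = [ id , (λ d₀≡0 → contradiction d₀≡0 d₀≢0) ]′
    (ℤₚ.i*j≡0⇒i≡0∨j≡0 a (≡.trans (≡.sym (coeff-⊗-zero (a ∷ p) d)) (at e 0)))
  tail : p ⊗ d ≐ []
  tail = coeffs λ i → begin
    coeff i (p ⊗ d)                                ≡⟨ ℤₚ.+-identityˡ _ ⟨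
    + 0 ℤ.* coeff (suc i) d ℤ.+ coeff i (p ⊗ d)    ≡⟨ cong (λ z → z ℤ.* coeff (suc i) d ℤ.+ coeff i (p ⊗ d)) a≡0 ⟨
    a ℤ.* coeff (suc i) d ℤ.+ coeff i (p ⊗ d)      ≡⟨ coeff-⊗-suc a p d i ⟨
    coeff (suc i) ((a ∷ p) ⊗ d)                    ≡⟨ at e (suc i) ⟩
    + 0                                            ∎
    where open ≡-Reasoning

⊗-cancelʳ : ∀ {d} → coeff 0 d ≢ + 0 → ∀ p q → p ⊗ d ≐ q ⊗ d → p ≐ q
⊗-cancelʳ {d} d₀≢0 p q e = begin
  p                   ≈⟨ ⊕-identityʳ p ⟨
  p ⊕ []              ≈⟨ ⊕-cong ≐-refl (≐-trans (⊕-comm (⊖ q) q) (⊕-inverseʳ q)) ⟨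
  p ⊕ (⊖ q ⊕ q)       ≈⟨ ⊕-assoc p (⊖ q) q ⟨
  (p ⊕ ⊖ q) ⊕ q       ≈⟨ ⊕-cong (⊗-annihilate d₀≢0 (p ⊕ ⊖ q) difference) ≐-refl ⟩
  q                   ∎
  where
  open ≐-Reasoning
  difference : (p ⊕ ⊖ q) ⊗ d ≐ []
  difference = begin
    (p ⊕ ⊖ q) ⊗ d           ≈⟨ ⊗-distribʳ d p (⊖ q) ⟩
    p ⊗ d ⊕ (⊖ q) ⊗ d       ≈⟨ ⊕-cong e (scale-⊗ (ℤ.- (+ 1)) q d) ⟩
    q ⊗ d ⊕ ⊖ (q ⊗ d)       ≈⟨ ⊕-inverseʳ (q ⊗ d) ⟩
    []                      ∎

IsUnit : ℤ → Set
IsUnit z = ∃ λ w → z ℤ.* w ≡ + 1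

IsUnit⇒≢0 : ∀ {z} → IsUnit z → z ≢ + 0
IsUnit⇒≢0 (w , zw≡1) ≡.refl = contradiction zw≡1 λ ()

module ℤ-Notation = RingNotation ℤₚ.+-*-commutativeRing

-- A unit constant term makes `d` invertible as a power series, so a common factor `c` of the
-- coefficients of `h ⊗ d` passes to `h`. The quotients `g` form a function, so that the induction
-- can correct them freely.
divisible-factor : ∀ c {d} → IsUnit (coeff 0 d) → ∀ h (g : ℕ → ℤ) →
                   (∀ i → coeff i (h ⊗ d) ≡ c ℤ.* g i) → ∃ λ h′ → h ≐ scale c h′
divisible-factor c u [] g e = [] , ≐-refl
divisible-factor c {d} (w , d₀w≡1) (a ∷ h) g e =
  let h′ , h≐ = divisible-factor c (w , d₀w≡1) h (λ i → g (suc i) ℤ.- a′ ℤ.* coeff (suc i) d) tail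
  in a′ ∷ h′ , ∷-cong a≡ca′ h≐
  where
  open ≡-Reasoning
  -- Comparing constant terms gives a d₀ = c g(0), and `w` is the inverse of d₀.
  a′ = g 0 ℤ.* w
  a≡ca′ : a ≡ c ℤ.* a′
  a≡ca′ = begin
    a                               ≡⟨ ℤₚ.*-identityʳ a ⟨
    a ℤ.* + 1                       ≡⟨ cong (a ℤ.*_) d₀w≡1 ⟨
    a ℤ.* (coeff 0 d ℤ.* w)         ≡⟨ ℤₚ.*-assoc a (coeff 0 d) w ⟨
    a ℤ.* coeff 0 d ℤ.* w           ≡⟨ cong (ℤ._* w) (coeff-⊗-zero (a ∷ h) d) ⟨
    coeff 0 ((a ∷ h) ⊗ d) ℤ.* w     ≡⟨ cong (ℤ._* w) (e 0) ⟩
    c ℤ.* g 0 ℤ.* w                 ≡⟨ ℤₚ.*-assoc c (g 0) w ⟩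
    c ℤ.* a′                        ∎
  tail : ∀ i → coeff i (h ⊗ d) ≡ c ℤ.* (g (suc i) ℤ.- a′ ℤ.* coeff (suc i) d)
  tail i = ℤ-Notation.⊞-cancelˡ (a ℤ.* t) _ _ (begin
    a ℤ.* t ℤ.+ coeff i (h ⊗ d)                                  ≡⟨ coeff-⊗-suc a h d i ⟨
    coeff (suc i) ((a ∷ h) ⊗ d)                                  ≡⟨ e (suc i) ⟩
    c ℤ.* g (suc i)                                              ≡⟨ cong (c ℤ.*_) (split (a′ ℤ.* t) (g (suc i))) ⟩
    c ℤ.* (a′ ℤ.* t ℤ.+ (g (suc i) ℤ.- a′ ℤ.* t))                ≡⟨ ℤₚ.*-distribˡ-+ c (a′ ℤ.* t) _ ⟩
    c ℤ.* (a′ ℤ.* t) ℤ.+ c ℤ.* (g (suc i) ℤ.- a′ ℤ.* t)          ≡⟨ cong (ℤ._+ c ℤ.* (g (suc i) ℤ.- a′ ℤ.* t)) (ℤₚ.*-assoc c a′ t) ⟨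
    c ℤ.* a′ ℤ.* t ℤ.+ c ℤ.* (g (suc i) ℤ.- a′ ℤ.* t)            ≡⟨ cong (λ z → z ℤ.* t ℤ.+ c ℤ.* (g (suc i) ℤ.- a′ ℤ.* t)) a≡ca′ ⟨
    a ℤ.* t ℤ.+ c ℤ.* (g (suc i) ℤ.- a′ ℤ.* t)                   ∎)
    where
    t = coeff (suc i) d
    split : ∀ x y → y ≡ x ℤ.+ (y ℤ.- x)
    split x y = begin
      y                        ≡⟨ ℤₚ.+-identityʳ y ⟨
      y ℤ.+ + 0                ≡⟨ cong (λ z → y ℤ.+ z) (ℤₚ.+-inverseˡ x) ⟨
      y ℤ.+ (ℤ.- x ℤ.+ x)      ≡⟨ ℤₚ.+-assoc y (ℤ.- x) x ⟨
      y ℤ.- x ℤ.+ x            ≡⟨ ℤₚ.+-comm (y ℤ.- x) x ⟩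
      x ℤ.+ (y ℤ.- x)          ∎

module Reversal     = Homogenization polyRing (constant (+ 1)) X
module Substitution (k : ℕ) = Homogenization polyRing (X ^ᵖ k) (constant (+ 1))

open Reversal using () renaming (homog to reversal)

∷ʳ-X : ∀ p a → p ∷ʳ a ≐ p ⊕ constant a ⊗ X ^ᵖ length p
∷ʳ-X []      a = ≐-sym (≐-trans (⊗-comm (constant a) _) (⊗-identityˡ (constant a)))
∷ʳ-X (b ∷ p) a = begin
  b ∷ (p ∷ʳ a)                                       ≈⟨ ∷-cong (≡.sym (ℤₚ.+-identityʳ b)) (∷ʳ-X p a) ⟩
  (b ∷ p) ⊕ (+ 0 ∷ constant a ⊗ X ^ᵖ length p)       ≈⟨ ⊕-cong (≐-refl {b ∷ p}) (X-⊗ (constant a ⊗ X ^ᵖ length p)) ⟨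
  (b ∷ p) ⊕ X ⊗ (constant a ⊗ X ^ᵖ length p)         ≈⟨ ⊕-cong (≐-refl {b ∷ p}) (swap X (constant a) (X ^ᵖ length p)) ⟩
  (b ∷ p) ⊕ constant a ⊗ X ^ᵖ length (b ∷ p)         ∎
  where
  open ≐-Reasoning
  swap : ∀ p q r → p ⊗ (q ⊗ r) ≐ q ⊗ (p ⊗ r)
  swap p q r = ≐-trans (≐-sym (⊗-assoc p q r)) (≐-trans (⊗-congʳ r (⊗-comm p q)) (⊗-assoc q p r))

-- Links the list operation used in `divMonic` to the multiplicative operation `reversal`. Trailing
-- zeros become leading ones under `reverse`, whence the exact length.
reverse-reversal : ∀ n p → length p ≡ suc n → reverse p ≐ reversal n p
reverse-reversal zero    (a ∷ [])    _ = ≐-sym (fromℤR-poly a)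
reverse-reversal (suc n) (a ∷ p)     l = begin
  reverse (a ∷ p)                                    ≡⟨ Listₚ.unfold-reverse a p ⟩
  reverse p ∷ʳ a                                     ≈⟨ ∷ʳ-X (reverse p) a ⟩
  reverse p ⊕ constant a ⊗ X ^ᵖ length (reverse p)   ≡⟨ cong (λ k → reverse p ⊕ constant a ⊗ X ^ᵖ k) (≡.trans (Listₚ.length-reverse p) (suc-injective l)) ⟩
  reverse p ⊕ constant a ⊗ X ^ᵖ suc n                ≈⟨ ⊕-comm (reverse p) _ ⟩
  constant a ⊗ X ^ᵖ suc n ⊕ reverse p                ≈⟨ ⊕-cong (⊗-congʳ (X ^ᵖ suc n) (≐-sym (fromℤR-poly a)))
                                                                (≐-trans (reverse-reversal n p (suc-injective l)) (≐-sym (⊗-identityˡ _))) ⟩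
  reversal (suc n) (a ∷ p)                           ∎
  where open ≐-Reasoning

-- The exact length rules out trailing zeros, to which `reverse` and `divH` are sensitive.
record Monic (n : ℕ) (p : Poly) : Set where
  constructor _,_
  field
    exact-length : length p ≡ suc n
    leading      : coeff n p ≡ + 1

open Monic

Monic⇒Bound : ∀ {n p} → Monic n p → Bound n p
Monic⇒Bound {p = p} (l , _) = Bound-length p (≤-reflexive l)

length-⊕ : ∀ p q → length (p ⊕ q) ≡ length p ℕ.⊔ length q
length-⊕ []      q       = ≡.refl
length-⊕ (a ∷ p) []      = ≡.refl
length-⊕ (a ∷ p) (b ∷ q) = cong suc (length-⊕ p q)

length-⊗ : ∀ n m p q → length p ≡ suc n → length q ≡ suc m → length (p ⊗ q) ≡ suc (n + m)
length-⊗ zero m (a ∷ []) q l l′ = begin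
  length (scale a q ⊕ (+ 0 ∷ []))    ≡⟨ length-⊕ (scale a q) _ ⟩
  length (scale a q) ℕ.⊔ 1           ≡⟨ cong (ℕ._⊔ 1) (≡.trans (Listₚ.length-map _ q) l′) ⟩
  suc m ℕ.⊔ 1                        ≡⟨ m≥n⇒m⊔n≡m (s≤s z≤n) ⟩
  suc m                              ∎
  where open ≡-Reasoning
length-⊗ (suc n) m (a ∷ p) q l l′ = begin
  length (scale a q ⊕ (+ 0 ∷ p ⊗ q))          ≡⟨ length-⊕ (scale a q) _ ⟩
  length (scale a q) ℕ.⊔ suc (length (p ⊗ q)) ≡⟨ cong₂ (λ x y → x ℕ.⊔ suc y) (≡.trans (Listₚ.length-map _ q) l′) (length-⊗ n m p q (suc-injective l) l′) ⟩
  suc m ℕ.⊔ suc (suc (n + m))                 ≡⟨ m≤n⇒m⊔n≡n (s≤s (m≤n+m m (suc n))) ⟩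
  suc (suc n + m)                             ∎
  where open ≡-Reasoning

Monic-⊗ : ∀ {n m p q} → Monic n p → Monic m q → Monic (n + m) (p ⊗ q)
Monic-⊗ {n} {m} {p} {q} u@(l , t) v@(l′ , t′) =
  length-⊗ n m p q l l′ ,
  ≡.trans (coeff-⊗-top n m p q (Monic⇒Bound u) (Monic⇒Bound v)) (cong₂ ℤ._*_ t t′)

withLength : ∀ n p → Bound n p → ∃ λ q → length q ≡ suc n × q ≐ p
withLength zero    []      b = constant (+ 0) , ≡.refl , 0∷[]≐[]
withLength zero    (a ∷ p) b = constant a , ≡.refl , ≐-sym (Bound-zero b)
withLength (suc n) []      b =
  let q , l , e = withLength n [] (λ _ _ → ≡.refl)
  in + 0 ∷ q , cong suc l , ≐-trans (∷-cong ≡.refl e) 0∷[]≐[]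
withLength (suc n) (a ∷ p) b =
  let q , l , e = withLength n p (Bound-tail b) in a ∷ q , cong suc l , ∷-cong ≡.refl e

-- A top coefficient of `h` above degree `n` would survive in `h ⊗ D`, being multiplied by the
-- leading coefficient 1. The bound is lowered one degree at a time, from a trivial one given by the
-- length of `h`.
Bound-quotient : ∀ n d h {D} → Monic d D → Bound (n + d) (h ⊗ D) → Bound n h
Bound-quotient n d h {D} D-monic b = descend (length h)
  (Bound-length h (≤-trans (m≤n+m (length h) n) (n≤1+n _)))
  where
  descend : ∀ k → Bound (n + k) h → Bound n h
  descend zero    b′ = subst (λ z → Bound z h) (+-identityʳ n) b′
  descend (suc k) b′ = descend k λ i n+k<i → lower i n+k<i (m≤n⇒m<n∨m≡n n+k<i)
    where
    top : coeff (n + suc k) h ≡ + 0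
    top = begin
      coeff (n + suc k) h                           ≡⟨ ℤₚ.*-identityʳ _ ⟨
      coeff (n + suc k) h ℤ.* + 1                   ≡⟨ cong (coeff (n + suc k) h ℤ.*_) (leading D-monic) ⟨
      coeff (n + suc k) h ℤ.* coeff d D             ≡⟨ coeff-⊗-top (n + suc k) d h D b′ (Monic⇒Bound D-monic) ⟨
      coeff (n + suc k + d) (h ⊗ D)                 ≡⟨ b _ (+-monoˡ-< d (m<m+n n (s≤s z≤n))) ⟩
      + 0                                           ∎
      where open ≡-Reasoning
    lower : ∀ i → n + k < i → suc (n + k) < i ⊎ suc (n + k) ≡ i → coeff i h ≡ + 0
    lower i _ (inj₁ lt) = b′ i (subst (_< i) (≡.sym (+-suc n k)) lt)
    lower i _ (inj₂ eq) = subst (λ z → coeff z h ≡ + 0) (≡.trans (+-suc n k) eq) top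

length-subPrefix : ∀ c d a → length (subPrefix c d a) ≡ length a
length-subPrefix c []      a       = ≡.refl
length-subPrefix c (x ∷ d) []      = ≡.refl
length-subPrefix c (x ∷ d) (y ∷ a) = cong suc (length-subPrefix c d a)

coeff-subPrefix : ∀ c d a → length d ≤ length a → ∀ i →
                  coeff i (subPrefix c d a) ≡ coeff i a ℤ.- c ℤ.* coeff i d
coeff-subPrefix c []      a       _       i = ≡.sym (begin
  coeff i a ℤ.- c ℤ.* + 0    ≡⟨ cong (λ z → coeff i a ℤ.- z) (ℤₚ.*-zeroʳ c) ⟩
  coeff i a ℤ.+ + 0          ≡⟨ ℤₚ.+-identityʳ _ ⟩
  coeff i a                  ∎)
  where open ≡-Reasoning
coeff-subPrefix c (x ∷ d) (y ∷ a) l       zero    = ≡.refl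
coeff-subPrefix c (x ∷ d) (y ∷ a) (s≤s l) (suc i) = coeff-subPrefix c d a l i

<ᵇ-true : ∀ {m n} → m < n → (m ℕ.<ᵇ n) ≡ true
<ᵇ-true {zero}  {suc n} _         = ≡.refl
<ᵇ-true {suc m} {suc n} (s≤s m<n) = <ᵇ-true m<n

<ᵇ-false : ∀ {m n} → n ≤ m → (m ℕ.<ᵇ n) ≡ false
<ᵇ-false {m}     {zero}  _         = ≡.refl
<ᵇ-false {suc m} {suc n} (s≤s n≤m) = <ᵇ-false n≤m

-- The lists are read highest degree first; ⊗ has the same meaning in that reading.
divH-exact : ∀ f d a b → length b ≤ f → length a ≡ length b + length d →
             a ≐ b ⊗ (+ 1 ∷ d) → divH f (+ 1 ∷ d) a ≡ b
divH-exact zero    d a       []      _ _ _ = ≡.refl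
divH-exact (suc f) d []      []      _ _ _ = ≡.refl
-- The quotient is used up: what remains of the dividend is one entry shorter than the divisor
-- `+ 1 ∷ d`, so the length test ends the division.
divH-exact (suc f) d (y ∷ a) []      _ l _
  rewrite <ᵇ-true {length (y ∷ a)} {suc (length d)} (s≤s (≤-reflexive l)) = ≡.refl
divH-exact (suc f) d (y ∷ a) (c ∷ b) (s≤s b≤f) l e
  rewrite <ᵇ-false {length (y ∷ a)} {suc (length d)} (≤-trans (s≤s (m≤n+m (length d) (length b))) (≤-reflexive (≡.sym l)))
  = cong₂ _∷_ y≡c (divH-exact f d _ b b≤f (≡.trans (length-subPrefix y d a) (suc-injective l)) rest)
  where
  open ≡-Reasoning
  y≡c : y ≡ c
  y≡c = begin
    y                                ≡⟨ at e 0 ⟩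
    coeff 0 ((c ∷ b) ⊗ (+ 1 ∷ d))    ≡⟨ coeff-⊗-zero (c ∷ b) (+ 1 ∷ d) ⟩
    c ℤ.* + 1                        ≡⟨ ℤₚ.*-identityʳ c ⟩
    c                                ∎
  rest : subPrefix y d a ≐ b ⊗ (+ 1 ∷ d)
  rest = coeffs λ i → begin
    coeff i (subPrefix y d a)                                                   ≡⟨ cong (λ z → coeff i (subPrefix z d a)) y≡c ⟩
    coeff i (subPrefix c d a)                                                   ≡⟨ coeff-subPrefix c d a (≤-trans (m≤n+m (length d) (length b)) (≤-reflexive (≡.sym (suc-injective l)))) i ⟩
    coeff i a ℤ.- c ℤ.* coeff i d                                               ≡⟨ cong (λ z → z ℤ.- c ℤ.* coeff i d) (≡.trans (at e (suc i)) (coeff-⊗-suc c b (+ 1 ∷ d) i)) ⟩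
    c ℤ.* coeff i d ℤ.+ coeff i (b ⊗ (+ 1 ∷ d)) ℤ.- c ℤ.* coeff i d             ≡⟨ cancel (c ℤ.* coeff i d) _ ⟩
    coeff i (b ⊗ (+ 1 ∷ d))                                                     ∎
    where
    cancel : ∀ x y → x ℤ.+ y ℤ.- x ≡ y
    cancel x y = begin
      x ℤ.+ y ℤ.- x        ≡⟨ cong (ℤ._- x) (ℤₚ.+-comm x y) ⟩
      y ℤ.+ x ℤ.- x        ≡⟨ ℤₚ.+-assoc y x (ℤ.- x) ⟩
      y ℤ.+ (x ℤ.- x)      ≡⟨ cong (λ z → y ℤ.+ z) (ℤₚ.+-inverseʳ x) ⟩
      y ℤ.+ + 0            ≡⟨ ℤₚ.+-identityʳ y ⟩
      y                    ∎

reverse-monic : ∀ d D → Monic d D → ∃ λ ds → reverse D ≡ + 1 ∷ ds × length ds ≡ d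
reverse-monic d D (l , t) with reverse D in eq
... | []     = contradiction (≡.trans (≡.sym l) (≡.trans (≡.sym (Listₚ.length-reverse D)) (cong length eq))) λ ()
... | x ∷ ds = ds , cong (_∷ ds) x≡1 , length-ds
  where
  open ≡-Reasoning
  length-ds : length ds ≡ d
  length-ds = suc-injective (≡.trans (≡.sym (cong length eq)) (≡.trans (Listₚ.length-reverse D) l))
  D≡ : D ≡ reverse ds ∷ʳ x
  D≡ = ≡.trans (≡.sym (Listₚ.reverse-involutive D)) (≡.trans (cong reverse eq) (Listₚ.unfold-reverse x ds))
  coeff-last : ∀ p → coeff (length p) (p ∷ʳ x) ≡ x
  coeff-last []      = ≡.refl
  coeff-last (_ ∷ p) = coeff-last p
  x≡1 : x ≡ + 1
  x≡1 = begin
    x                                                    ≡⟨ coeff-last (reverse ds) ⟨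
    coeff (length (reverse ds)) (reverse ds ∷ʳ x)        ≡⟨ cong₂ coeff (≡.trans (Listₚ.length-reverse ds) length-ds) (≡.sym D≡) ⟩
    coeff d D                                            ≡⟨ t ⟩
    + 1                                                  ∎

-- Reversal is multiplicative, so it turns a = b D into a product of the reversed lists, which is
-- divided from its lowest entry upwards. Fixing all lengths yields equality of lists and not just
-- of polynomials.
divMonic-exact : ∀ e d a b D → Monic d D → length b ≡ suc e → length a ≡ suc (e + d) →
                 a ≐ b ⊗ D → divMonic a D ≡ b
divMonic-exact e d a b D D-monic@(lD , _) lb la a≐bD with reverse-monic d D D-monic
... | ds , rD , lds = begin
  reverse (divH (length a) (reverse D) (reverse a))    ≡⟨ cong (λ z → reverse (divH (length a) z (reverse a))) rD ⟩
  reverse (divH (length a) (+ 1 ∷ ds) (reverse a))     ≡⟨ cong reverse (divH-exact (length a) ds (reverse a) (reverse b) fuel lengths product) ⟩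
  reverse (reverse b)                                  ≡⟨ Listₚ.reverse-involutive b ⟩
  b                                                    ∎
  where
  open ≡-Reasoning
  fuel : length (reverse b) ≤ length a
  fuel = ≤-trans (≤-reflexive (≡.trans (Listₚ.length-reverse b) lb))
    (≤-trans (s≤s (m≤m+n e d)) (≤-reflexive (≡.sym la)))
  lengths : length (reverse a) ≡ length (reverse b) + length ds
  lengths = ≡.trans (Listₚ.length-reverse a) (≡.trans la
    (≡.sym (cong₂ _+_ (≡.trans (Listₚ.length-reverse b) lb) lds)))
  product : reverse a ≐ reverse b ⊗ (+ 1 ∷ ds)
  product = ≐-trans (reverse-reversal (e + d) a la)
    (≐-trans (Reversal.homog-cong (e + d) a≐bD)
    (≐-trans (Reversal.homog-⊗ e d b D (Bound-length b (≤-reflexive lb)) (Monic⇒Bound D-monic))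
    (⊗-cong (≐-sym (reverse-reversal e b lb))
      (≐-trans (≐-sym (reverse-reversal d D lD)) (coeffs λ i → cong (coeff i) rD)))))

-- Ideals containing xᵐ - 1 and xⁿ - 1

module IntegerSolver {c ℓ} (R : CommutativeRing c ℓ) where
  open RingNotation R
  open IntegerImage R

  -- Sends + 1 to 1# itself, whereas ⟦ + 1 ⟧ is 1# ⊞ 0#.
  image : ℤ → Carrier
  image (+ 1) = 1#
  image z     = ⟦ z ⟧

  image≈ : ∀ z → image z ≈ ⟦ z ⟧
  image≈ (+ 0)           = refl
  image≈ (+ 1)           = sym fromℤR-one
  image≈ (+ suc (suc n)) = refl
  image≈ -[1+ n ]        = refl

  private
    R′ = fromCommutativeRing R

    morphism : CommutativeRing.rawRing ℤₚ.+-*-commutativeRing -Raw-AlmostCommutative⟶ R′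
    morphism = record
      { ⟦_⟧    = image
      ; +-homo = λ i j → trans (image≈ (i ℤ.+ j)) (trans (fromℤR-+ i j) (sym (⊞-cong (image≈ i) (image≈ j))))
      ; *-homo = λ i j → trans (image≈ (i ℤ.* j)) (trans (fromℤR-* i j) (sym (·-cong (image≈ i) (image≈ j))))
      ; -‿homo = λ i → trans (image≈ (ℤ.- i)) (trans (fromℤR-neg i) (sym (⊟-cong (image≈ i))))
      ; 0-homo = refl
      ; 1-homo = refl
      }

    _coeff≟_ : ∀ i j → Maybe (image i ≈ image j)
    i coeff≟ j with i ℤ.≟ j
    ... | yes i≡j = just (reflexive (cong image i≡j))
    ... | no _    = nothing

  open RingSolver _ R′ morphism _coeff≟_ public
    using (solve; _:=_; _:+_; _:*_; :-_; con)

module Negation {c ℓ} (R : CommutativeRing c ℓ) where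
  open RingNotation R
  open IntegerSolver R

  minus-minus : ∀ z → ⊟ 1# · (1# ⊞ ⊟ z) ≈ z ⊞ ⊟ 1#
  minus-minus z = solve 1 (λ z → (:- con (+ 1)) :* (con (+ 1) :+ :- z) := z :+ :- con (+ 1)) refl z

  odd-power-neg : ∀ z n → ¬ 2 ∣ n → ⊟ (z ^^ n) ≈ (⊟ z) ^^ n
  odd-power-neg z 0             2∤0 = contradiction (2 ∣0) 2∤0
  odd-power-neg z 1             _   = ⊟-distribˡ-· z 1#
  odd-power-neg z (suc (suc n)) 2∤  = trans
    (solve 2 (λ z w → :- (z :* (z :* w)) := (:- z) :* ((:- z) :* (:- w))) refl z (z ^^ n))
    (·-congˡ (·-congˡ (odd-power-neg z n λ 2∣n → 2∤ (∣m∣n⇒∣m+n ∣-refl 2∣n))))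

module GeometricSum {c ℓ} (R : CommutativeRing c ℓ) where
  open RingNotation R
  open ≈-Reasoning
  open IntegerSolver R

  minusOne : Carrier → Carrier
  minusOne y = y ⊞ ⊟ 1#

  geometric : Carrier → ℕ → Carrier
  geometric y zero    = 0#
  geometric y (suc e) = 1# ⊞ y · geometric y e

  geometric-telescopes : ∀ y e → geometric y e · minusOne y ≈ minusOne (y ^^ e)
  geometric-telescopes y zero    = trans (·-zeroˡ _) (sym (⊟-inverseʳ 1#))
  geometric-telescopes y (suc e) = begin
    (1# ⊞ y · G) · minusOne y               ≈⟨ solve 2 (λ y G → (con (+ 1) :+ y :* G) :* (y :+ :- con (+ 1))
                                                  := (y :+ :- con (+ 1)) :+ y :* (G :* (y :+ :- con (+ 1)))) refl y G ⟩
    minusOne y ⊞ y · (G · minusOne y)       ≈⟨ ⊞-congˡ (·-congˡ (geometric-telescopes y e)) ⟩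
    minusOne y ⊞ y · minusOne (y ^^ e)      ≈⟨ solve 2 (λ y z → (y :+ :- con (+ 1)) :+ y :* (z :+ :- con (+ 1))
                                                  := y :* z :+ :- con (+ 1)) refl y (y ^^ e) ⟩
    minusOne (y · y ^^ e)                   ∎
    where G = geometric y e

module Ideal₂ {c ℓ} (R : CommutativeRing c ℓ) (a b : CommutativeRing.Carrier R) where
  open RingNotation R
  open RingPowers R
  open ≈-Reasoning
  open IntegerSolver R
  open GeometricSum R

  record InIdeal (z : Carrier) : Set (c ⊔ ℓ) where
    constructor combination
    field
      u v      : Carrier
      equation : z ≈ u · a ⊞ v · b

  generator₁ : ∀ {z} u → z ≈ u · a → InIdeal z
  generator₁ u e = combination u 0#
    (trans e (sym (trans (⊞-congˡ (·-zeroˡ b)) (⊞-identityʳ _))))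

  generator₂ : ∀ {z} v → z ≈ v · b → InIdeal z
  generator₂ v e = combination 0# v
    (trans e (sym (trans (⊞-congʳ (·-zeroˡ a)) (⊞-identityˡ _))))

  InIdeal-cong : ∀ {z w} → z ≈ w → InIdeal z → InIdeal w
  InIdeal-cong e (combination u v eq) = combination u v (trans (sym e) eq)

  InIdeal-lincomb : ∀ {z w} x y → InIdeal z → InIdeal w → InIdeal (x · z ⊞ y · w)
  InIdeal-lincomb {z} {w} x y (combination u v eq) (combination u′ v′ eq′) =
    combination (x · u ⊞ y · u′) (x · v ⊞ y · v′) (begin
      x · z ⊞ y · w
        ≈⟨ ⊞-cong (·-congˡ eq) (·-congˡ eq′) ⟩
      x · (u · a ⊞ v · b) ⊞ y · (u′ · a ⊞ v′ · b)
        ≈⟨ solve 8 (λ x y u v u′ v′ a b → x :* (u :* a :+ v :* b) :+ y :* (u′ :* a :+ v′ :* b)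
                     := (x :* u :+ y :* u′) :* a :+ (x :* v :+ y :* v′) :* b)
                 refl x y u v u′ v′ a b ⟩
      (x · u ⊞ y · u′) · a ⊞ (x · v ⊞ y · v′) · b
        ∎)

  InIdeal-zero : InIdeal 0#
  InIdeal-zero = generator₁ 0# (sym (·-zeroˡ a))

  InIdeal-power : ∀ x m k → InIdeal (minusOne (x ^^ m)) → InIdeal (minusOne (x ^^ (k * m)))
  InIdeal-power x m zero    h = InIdeal-cong (sym (⊟-inverseʳ 1#)) InIdeal-zero
  InIdeal-power x m (suc k) h = InIdeal-cong
    (trans (solve 2 (λ p q → p :* (q :+ :- con (+ 1)) :+ con (+ 1) :* (p :+ :- con (+ 1))
                      := p :* q :+ :- con (+ 1)) refl (x ^^ m) (x ^^ (k * m)))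
           (⊞-congʳ (sym (^^-+ x m (k * m)))))
    (InIdeal-lincomb (x ^^ m) 1# (InIdeal-power x m k h) h)

  -- A step of Euclid's algorithm in the exponent: x^d - 1 = (x^(d+k) - 1) - x^d (x^k - 1).
  InIdeal-subtract : ∀ x d k l → d + k ≡ l → InIdeal (minusOne (x ^^ k)) →
                     InIdeal (minusOne (x ^^ l)) → InIdeal (minusOne (x ^^ d))
  InIdeal-subtract x d k l ≡.refl h h′ = InIdeal-cong
    (trans (⊞-congˡ (·-congˡ (⊞-congʳ (^^-+ x d k))))
           (solve 2 (λ p q → (:- p) :* (q :+ :- con (+ 1)) :+ con (+ 1) :* (p :* q :+ :- con (+ 1))
                      := p :+ :- con (+ 1)) refl (x ^^ d) (x ^^ k)))
    (InIdeal-lincomb (⊟ (x ^^ d)) 1# h h′)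

  -- Bézout's identity over ℕ writes the gcd as a difference of multiples of `m` and `n`, in one
  -- order or the other, so no negative power of `x` occurs.
  InIdeal-gcd : ∀ x m n → InIdeal (minusOne (x ^^ m)) → InIdeal (minusOne (x ^^ n)) →
                InIdeal (minusOne (x ^^ gcd m n))
  InIdeal-gcd x m n h h′ with Bézout.identity (gcd-GCD m n)
  ... | Bézout.+- k l eq = InIdeal-subtract x (gcd m n) (l * n) (k * m) eq
                             (InIdeal-power x n l h′) (InIdeal-power x m k h)
  ... | Bézout.-+ k l eq = InIdeal-subtract x (gcd m n) (k * m) (l * n) eq
                             (InIdeal-power x m k h) (InIdeal-power x n l h′)

  -- Modulo y - 1 each of the `e` powers of `y` in the sum is 1.
  InIdeal-geometric : ∀ y e → InIdeal (minusOne y) → InIdeal (geometric y e ⊞ ⊟ fromℕR R e)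
  InIdeal-geometric y zero    h = InIdeal-cong (sym (⊟-inverseʳ 0#)) InIdeal-zero
  InIdeal-geometric y (suc e) h = InIdeal-cong
    (solve 3 (λ y G n → G :* (y :+ :- con (+ 1)) :+ con (+ 1) :* (G :+ :- n)
                := (con (+ 1) :+ y :* G) :+ :- (con (+ 1) :+ n)) refl y (geometric y e) (fromℕR R e))
    (InIdeal-lincomb (geometric y e) 1# h (InIdeal-geometric y e h))

  InIdeal-ℕ : ∀ y e → InIdeal (minusOne y) → InIdeal (geometric y e) → InIdeal (fromℕR R e)
  InIdeal-ℕ y e h h′ = InIdeal-cong
    (solve 2 (λ G n → con (+ 1) :* G :+ (:- con (+ 1)) :* (G :+ :- n) := n)
      refl (geometric y e) (fromℕR R e))
    (InIdeal-lincomb 1# (⊟ 1#) h′ (InIdeal-geometric y e h))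

module IdealProduct {c ℓ} (R : CommutativeRing c ℓ) where
  open RingNotation R
  open ≈-Reasoning
  open IntegerSolver R
  open Ideal₂ R

  -- When the two combinations are multiplied out, every term except the one with p q contains `r`.
  InIdeal-product : ∀ {p q r z w} → InIdeal p r z → InIdeal q r w → InIdeal (p · q) r (z · w)
  InIdeal-product {p} {q} {r} {z} {w} (combination u v eq) (combination u′ v′ eq′) =
    combination (u · u′) (u · p · v′ ⊞ v · (u′ · q ⊞ v′ · r)) (begin
      z · w
        ≈⟨ ·-cong eq eq′ ⟩
      (u · p ⊞ v · r) · (u′ · q ⊞ v′ · r)
        ≈⟨ solve 7 (λ u p v r u′ q v′ → (u :* p :+ v :* r) :* (u′ :* q :+ v′ :* r)
             := (u :* u′) :* (p :* q) :+ (u :* p :* v′ :+ v :* (u′ :* q :+ v′ :* r)) :* r)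
             refl u p v r u′ q v′ ⟩
      u · u′ · (p · q) ⊞ (u · p · v′ ⊞ v · (u′ · q ⊞ v′ · r)) · r
        ∎)

  -- Multiply z = u p + v q by the cofactor `G`: since G p = F = H q, both terms on the right are
  -- multiples of `q`.
  common-multiple : ∀ {p q z F G H} → InIdeal p q z → F ≈ G · p → F ≈ H · q →
                    ∃ λ K → K · q ≈ z · G
  common-multiple {p} {q} {z} {F} {G} {H} (combination u v eq) e e′ = u · H ⊞ v · G , (begin
    (u · H ⊞ v · G) · q          ≈⟨ solve 5 (λ u H v G q → (u :* H :+ v :* G) :* q := u :* (H :* q) :+ v :* q :* G) refl u H v G q ⟩
    u · (H · q) ⊞ v · q · G      ≈⟨ ⊞-congʳ (·-congˡ (trans (sym e′) e)) ⟩
    u · (G · p) ⊞ v · q · G      ≈⟨ solve 5 (λ u p v G q → u :* (G :* p) :+ v :* q :* G := (u :* p :+ v :* q) :* G) refl u p v G q ⟩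
    (u · p ⊞ v · q) · G          ≈⟨ ·-congʳ eq ⟨
    z · G                        ∎)

-- The product formula for cyclotomic polynomials

module Prod = RangeFold (CommutativeRing.*-commutativeMonoid polyRing)

open Ideal₂ polyRing using (InIdeal; combination)

-- Comaximality in ℚ[q], witnessed inside ℤ[q] by a nonzero integer of the ideal.
Comaximal : Poly → Poly → Set
Comaximal p q = ∃ λ c → c ≢ + 0 × InIdeal p q (constant c)

Comaximal-one : ∀ r → Comaximal (constant (+ 1)) r
Comaximal-one r = + 1 , (λ ()) ,
  Ideal₂.generator₁ polyRing (constant (+ 1)) r (constant (+ 1)) (≐-sym (⊗-identityˡ (constant (+ 1))))

Comaximal-⊗ : ∀ {p q r} → Comaximal p r → Comaximal q r → Comaximal (p ⊗ q) r
Comaximal-⊗ {p} {q} {r} (c , c≢0 , h) (d , d≢0 , h′) =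
  c ℤ.* d , (λ cd≡0 → [ c≢0 , d≢0 ]′ (ℤₚ.i*j≡0⇒i≡0∨j≡0 c cd≡0)) ,
  Ideal₂.InIdeal-cong polyRing (p ⊗ q) r (∷-cong (ℤₚ.+-identityʳ (c ℤ.* d)) ≐-refl)
    (IdealProduct.InIdeal-product polyRing h h′)

scale-cancel : ∀ c {p q} → c ≢ + 0 → scale c p ≐ scale c q → p ≐ q
scale-cancel c {p} {q} c≢0 e = coeffs λ i → ℤₚ.*-cancelˡ-≡ c (coeff i p) (coeff i q) {{ℤ.≢-nonZero c≢0}}
  (≡.trans (≡.sym (coeff-scale c p i)) (≡.trans (at e i) (coeff-scale c q i)))

-- Comaximality gives K q = c G for the cofactor `G` of `p`. As `q` has a unit constant term, `c`
-- divides `K`; cancelling it leaves `G` as a multiple of `q`.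
Comaximal-divide : ∀ {p q F} → Comaximal p q → IsUnit (coeff 0 q) →
  (∃ λ G → F ≐ G ⊗ p) → (∃ λ H → F ≐ H ⊗ q) → ∃ λ K → F ≐ K ⊗ (p ⊗ q)
Comaximal-divide {p} {q} {F} (c , c≢0 , h) q₀ (G , F≐Gp) (H , F≐Hq) =
  let K , Kq≐cG = IdealProduct.common-multiple polyRing {F = F} {G} {H} h F≐Gp F≐Hq
      K′ , K≐cK′ = divisible-factor c q₀ K (λ i → coeff i G) (λ i →
        ≡.trans (at (≐-trans Kq≐cG (constant-⊗ c G)) i) (coeff-scale c G i))
      K′q≐G : K′ ⊗ q ≐ G
      K′q≐G = scale-cancel c c≢0 (begin
        scale c (K′ ⊗ q)     ≈⟨ scale-⊗ c K′ q ⟨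
        scale c K′ ⊗ q       ≈⟨ ⊗-congʳ q K≐cK′ ⟨
        K ⊗ q                ≈⟨ Kq≐cG ⟩
        constant c ⊗ G       ≈⟨ constant-⊗ c G ⟩
        scale c G            ∎)
  in K′ , (begin
    F                    ≈⟨ F≐Gp ⟩
    G ⊗ p                ≈⟨ ⊗-congʳ p K′q≐G ⟨
    K′ ⊗ q ⊗ p           ≈⟨ ⊗-assoc K′ q p ⟩
    K′ ⊗ (q ⊗ p)         ≈⟨ ⊗-congˡ K′ (⊗-comm q p) ⟩
    K′ ⊗ (p ⊗ q)         ∎)
  where open ≐-Reasoning

X^n-1 : ℕ → Poly
X^n-1 n = X ^ᵖ n ⊕ ⊖ constant (+ 1)

X^≐shift : ∀ n → X ^ᵖ n ≐ shift n (constant (+ 1))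
X^≐shift n = ≐-sym (≐-trans (shift-X n (constant (+ 1)))
  (≐-trans (⊗-comm (X ^ᵖ n) (constant (+ 1))) (⊗-identityˡ (X ^ᵖ n))))

qPowMinusOne≐ : ∀ n → 1 ≤ n → qPowMinusOne n ≐ X^n-1 n
qPowMinusOne≐ (suc n) _ = ≐-sym (≐-trans
  (⊕-cong (X^≐shift (suc n)) ≐-refl)
  (∷-cong ≡.refl (⊕-identityʳ (shift n (constant (+ 1))))))

length-qPowMinusOne : ∀ n → 1 ≤ n → length (qPowMinusOne n) ≡ suc n
length-qPowMinusOne (suc n) _ = cong suc (≡.trans (Listₚ.length-++ (replicate n (+ 0)))
  (≡.trans (cong (_+ 1) (Listₚ.length-replicate n)) (+-comm n 1)))

leading-qPowMinusOne : ∀ n → 1 ≤ n → coeff n (qPowMinusOne n) ≡ + 1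
leading-qPowMinusOne (suc n) _ = go n
  where
  go : ∀ n → coeff n (shift n (constant (+ 1))) ≡ + 1
  go zero    = ≡.refl
  go (suc n) = go n

-- The two properties are proved together: the division that defines the next `Φ` relies on the
-- degrees of its predecessors as well as on their product formulas.
record IsCyclotomic (N : ℕ) : Set where
  field
    monic   : Monic (totient N) (Φ N)
    product : Prod.foldDivisors N Φ ≐ qPowMinusOne N

open IsCyclotomic

properPart : ℕ → Poly
properPart N = Prod.fold N (λ d → Prod.when (d ∣? N) (Φ d))

properPart-⊗ : ∀ {N} → IsCyclotomic N → properPart N ⊗ Φ N ≐ qPowMinusOne N
properPart-⊗ {N} C = ≐-trans (≐-sym (Prod.foldDivisors-split N Φ)) (product C)

-- The constant term of q^N - 1 is -1, so the proper part supplies the inverse up to sign.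
constant-term-Φ : ∀ N → 1 ≤ N → IsCyclotomic N → IsUnit (coeff 0 (Φ N))
constant-term-Φ (suc n) _ C = ℤ.- coeff 0 P , (begin
  coeff 0 Φₙ ℤ.* (ℤ.- coeff 0 P)           ≡⟨ ℤₚ.*-comm (coeff 0 Φₙ) (ℤ.- coeff 0 P) ⟩
  ℤ.- coeff 0 P ℤ.* coeff 0 Φₙ             ≡⟨ ℤₚ.neg-distribˡ-* (coeff 0 P) (coeff 0 Φₙ) ⟨
  ℤ.- (coeff 0 P ℤ.* coeff 0 Φₙ)           ≡⟨ cong ℤ.-_ (coeff-⊗-zero P Φₙ) ⟨
  ℤ.- coeff 0 (P ⊗ Φₙ)                     ≡⟨ cong ℤ.-_ (at (properPart-⊗ {suc n} C) 0) ⟩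
  + 1                                      ∎)
  where
  open ≡-Reasoning
  P  = properPart (suc n)
  Φₙ = Φ (suc n)

X^n-1-nonzero : ∀ n → 1 ≤ n → coeff 0 (X^n-1 n) ≢ + 0
X^n-1-nonzero n@(suc _) 1≤n e with ≡.trans (at (qPowMinusOne≐ n 1≤n) 0) e
... | ()

open GeometricSum polyRing using () renaming (geometric to geom; geometric-telescopes to geom-telescopes)

^ᵖ-*-comm : ∀ g e → (X ^ᵖ g) ^ᵖ e ≐ X ^ᵖ (e * g)
^ᵖ-*-comm g e = ≐-sym (Poly-Powers.^^-* X e g)

X^n-1-divides : ∀ g e → X^n-1 (e * g) ≐ geom (X ^ᵖ g) e ⊗ X^n-1 g
X^n-1-divides g e = ≐-sym (≐-trans (geom-telescopes (X ^ᵖ g) e) (⊕-cong (^ᵖ-*-comm g e) ≐-refl))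

-- Since g < j, all divisors of `g` are among the proper divisors of `j`, and the product over them
-- is X^g - 1.
properPart-divides : ∀ {g j} → 1 ≤ g → g < j → g ∣ j → IsCyclotomic g →
                     ∃ λ W → properPart j ≐ W ⊗ X^n-1 g
properPart-divides {g} {j} 1≤g g<j g∣j C = rest , (begin
  properPart j                     ≈⟨ Prod.fold-cong j (λ d _ → split d) ⟩
  Prod.fold j (λ d → inner d ⊗ outer d)   ≈⟨ Prod.fold-∙ j inner outer ⟩
  Prod.fold j inner ⊗ rest         ≈⟨ ⊗-congʳ rest (Prod.foldDivisors-range Φ 1≤g g<j) ⟩
  Prod.foldDivisors g Φ ⊗ rest     ≈⟨ ⊗-congʳ rest (≐-trans (product C) (qPowMinusOne≐ g 1≤g)) ⟩
  X^n-1 g ⊗ rest                   ≈⟨ ⊗-comm (X^n-1 g) rest ⟩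
  rest ⊗ X^n-1 g                   ∎)
  where
  open ≐-Reasoning
  inner outer : ℕ → Poly
  inner d = Prod.when (d ∣? g) (Φ d)
  outer d = Prod.when (d ∣? j) (Prod.when (¬? (d ∣? g)) (Φ d))
  rest = Prod.fold j outer
  split : ∀ d → Prod.when (d ∣? j) (Φ d) ≐ inner d ⊗ outer d
  split d with d ∣? g | d ∣? j
  ... | yes d∣g | yes _   = ≐-sym (≐-trans (⊗-comm (Φ d) (constant (+ 1))) (⊗-identityˡ (Φ d)))
  ... | yes d∣g | no d∤j  = contradiction (∣-trans d∣g g∣j) d∤j
  ... | no _    | yes _   = ≐-sym (⊗-identityˡ (Φ d))
  ... | no _    | no _    = ≐-sym (⊗-identityˡ (constant (+ 1)))

-- With g = gcd i j, the ideal (Φᵢ, Φⱼ) contains X^g - 1, and Φⱼ divides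
-- (X^j - 1) / (X^g - 1), which is congruent to j / g modulo X^g - 1.
Comaximal-Φ : ∀ i j → 1 ≤ i → i < j → IsCyclotomic i → IsCyclotomic j →
              (∀ g → 1 ≤ g → g ≤ i → IsCyclotomic g) → Comaximal (Φ i) (Φ j)
Comaximal-Φ i j 1≤i i<j Cᵢ Cⱼ C = go (gcd[m,n]∣n i j)
  where
  module I = Ideal₂ polyRing (Φ i) (Φ j)
  g = gcd i j
  1≤j : 1 ≤ j
  1≤j = <-trans 1≤i i<j
  1≤g : 1 ≤ g
  1≤g = ℕ.>-nonZero⁻¹ g {{≢-nonZero (gcd[m,n]≢0 i j (inj₁ (m<n⇒n≢0 1≤i)))}}
  g≤i : g ≤ i
  g≤i = ∣⇒≤ {{>-nonZero 1≤i}} (gcd[m,n]∣m i j)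
  open ≐-Reasoning

  X^g-1∈ : I.InIdeal (X^n-1 g)
  X^g-1∈ = I.InIdeal-gcd X i j
    (I.generator₁ (properPart i) (≐-sym (≐-trans (properPart-⊗ Cᵢ) (qPowMinusOne≐ i 1≤i))))
    (I.generator₂ (properPart j) (≐-sym (≐-trans (properPart-⊗ Cⱼ) (qPowMinusOne≐ j 1≤j))))

  go : g ∣ j → Comaximal (Φ i) (Φ j)
  go (divides e j≡eg) = + e , e≢0 , I.InIdeal-cong (fromℕR-poly e)
    (I.InIdeal-ℕ (X ^ᵖ g) e X^g-1∈ (I.generator₂ W geom≐WΦ))
    where
    e≢0 : + e ≢ + 0
    e≢0 ≡.refl = m<n⇒n≢0 1≤j j≡eg
    factor = properPart-divides 1≤g (≤-<-trans g≤i i<j) (gcd[m,n]∣n i j) (C g 1≤g g≤i)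
    W = proj₁ factor
    geom≐WΦ : geom (X ^ᵖ g) e ≐ W ⊗ Φ j
    -- Both sides become X^j - 1 once multiplied by X^g - 1.
    geom≐WΦ = ⊗-cancelʳ (X^n-1-nonzero g 1≤g) _ _ (begin
      geom (X ^ᵖ g) e ⊗ X^n-1 g      ≈⟨ X^n-1-divides g e ⟨
      X^n-1 (e * g)                  ≡⟨ cong X^n-1 j≡eg ⟨
      X^n-1 j                        ≈⟨ qPowMinusOne≐ j 1≤j ⟨
      qPowMinusOne j                 ≈⟨ properPart-⊗ Cⱼ ⟨
      properPart j ⊗ Φ j             ≈⟨ ⊗-congʳ (Φ j) (proj₂ factor) ⟩
      W ⊗ X^n-1 g ⊗ Φ j              ≈⟨ ⊗-assoc W (X^n-1 g) (Φ j) ⟩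
      W ⊗ (X^n-1 g ⊗ Φ j)            ≈⟨ ⊗-congˡ W (⊗-comm (X^n-1 g) (Φ j)) ⟩
      W ⊗ (Φ j ⊗ X^n-1 g)            ≈⟨ ⊗-assoc W (Φ j) (X^n-1 g) ⟨
      W ⊗ Φ j ⊗ X^n-1 g              ∎)

-- The divisor product inside the definition of `Φ`

zipped : ℕ → List (ℕ × Poly)
zipped n = zip (map suc (upTo n)) (cycloList n)

length-cycloList : ∀ n → length (cycloList n) ≡ n
length-cycloList zero    = ≡.refl
length-cycloList (suc n) = ≡.trans (Listₚ.length-++ (cycloList n))
  (≡.trans (cong (_+ 1) (length-cycloList n)) (+-comm n 1))

zip-∷ʳ : {A B : Set} (xs : List A) (ys : List B) {x : A} {y : B} → length xs ≡ length ys →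
         zip (xs ∷ʳ x) (ys ∷ʳ y) ≡ zip xs ys ∷ʳ (x , y)
zip-∷ʳ []       []       _ = ≡.refl
zip-∷ʳ (x ∷ xs) (y ∷ ys) l = cong (_ ∷_) (zip-∷ʳ xs ys (suc-injective l))

zipped-suc : ∀ n → zipped (suc n) ≡ zipped n ∷ʳ (suc n , Φ (suc n))
zipped-suc n = begin
  zip (map suc (upTo (suc n))) (cycloList (suc n))     ≡⟨ cong (λ xs → zip (map suc xs) (cycloList (suc n))) (Listₚ.upTo-∷ʳ n) ⟨
  zip (map suc (upTo n ∷ʳ n)) (cycloList (suc n))      ≡⟨ cong (λ xs → zip xs (cycloList (suc n))) (Listₚ.map-++ suc (upTo n) (n ∷ [])) ⟩
  zip (map suc (upTo n) ∷ʳ suc n) (cycloList (suc n))  ≡⟨ zip-∷ʳ (map suc (upTo n)) (cycloList n)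
                                                           (≡.trans (Listₚ.length-map suc (upTo n))
                                                             (≡.trans (Listₚ.length-upTo n) (≡.sym (length-cycloList n)))) ⟩
  zipped n ∷ʳ (suc n , Φ (suc n))                      ∎
  where open ≡-Reasoning

module _ (N : ℕ) (1≤N : 1 ≤ N) where

  -- `zipped` grows at the right end, where `foldr` begins. A general accumulator is needed for the
  -- induction to absorb the last entry.
  listProduct : Poly → List (ℕ × Poly) → Poly
  listProduct acc xs = foldr _⊗_ acc (map proj₂ (filter (λ dΦ → proj₁ dΦ ∣? N) xs))

  step : Poly → ℕ → Poly
  step acc d = listProduct acc ((d , Φ d) ∷ [])

  listProduct-suc : ∀ acc n → listProduct acc (zipped (suc n)) ≡ listProduct (step acc (suc n)) (zipped n)
  listProduct-suc acc n = begin
    listProduct acc (zipped (suc n))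
      ≡⟨ cong (listProduct acc) (zipped-suc n) ⟩
    foldr _⊗_ acc (map proj₂ (filter P? (zipped n ∷ʳ x)))
      ≡⟨ cong (λ xs → foldr _⊗_ acc (map proj₂ xs)) (Listₚ.filter-++ P? (zipped n) (x ∷ [])) ⟩
    foldr _⊗_ acc (map proj₂ (filter P? (zipped n) ++ filter P? (x ∷ [])))
      ≡⟨ cong (foldr _⊗_ acc) (Listₚ.map-++ proj₂ (filter P? (zipped n)) _) ⟩
    foldr _⊗_ acc (map proj₂ (filter P? (zipped n)) ++ map proj₂ (filter P? (x ∷ [])))
      ≡⟨ Listₚ.foldr-++ _⊗_ acc (map proj₂ (filter P? (zipped n))) _ ⟩
    listProduct (step acc (suc n)) (zipped n)
      ∎
    where
    open ≡-Reasoning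
    x  = suc n , Φ (suc n)
    P? = λ (dΦ : ℕ × Poly) → proj₁ dΦ ∣? N

  step≐ : ∀ acc d → step acc d ≐ Prod.when (d ∣? N) (Φ d) ⊗ acc
  step≐ acc d with d ∣? N
  ... | yes _ = ≐-refl
  ... | no _  = ≐-sym (⊗-identityˡ acc)

  step-monic : ∀ {e acc d} → Monic (totient d) (Φ d) → Monic e acc →
               Monic (Sum.when (d ∣? N) (totient d) + e) (step acc d)
  step-monic {d = d} m m′ with d ∣? N
  ... | yes _ = Monic-⊗ m m′
  ... | no _  = m′

  listProduct≐ : ∀ n acc → listProduct acc (zipped n) ≐
                 Prod.fold (suc n) (λ d → Prod.when (d ∣? N) (Φ d)) ⊗ acc
  listProduct≐ zero    acc = ≐-sym (≐-trans
    (⊗-congʳ acc (≐-trans (⊗-identityˡ _) (Prod.when-no (0 ∣? N) (m<n⇒n≢0 1≤N ∘ 0∣⇒≡0))))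
    (⊗-identityˡ acc))
  listProduct≐ (suc n) acc = begin
    listProduct acc (zipped (suc n))                                     ≡⟨ listProduct-suc acc n ⟩
    listProduct (step acc (suc n)) (zipped n)                            ≈⟨ listProduct≐ n _ ⟩
    Prod.fold (suc n) f ⊗ step acc (suc n)                               ≈⟨ ⊗-congˡ (Prod.fold (suc n) f) (step≐ acc (suc n)) ⟩
    Prod.fold (suc n) f ⊗ (f (suc n) ⊗ acc)                              ≈⟨ ⊗-assoc (Prod.fold (suc n) f) (f (suc n)) acc ⟨
    Prod.fold (suc (suc n)) f ⊗ acc                                      ∎
    where
    open ≐-Reasoning
    f = λ d → Prod.when (d ∣? N) (Φ d)

  -- Exact length is not invariant under `≐`, so the degree is tracked through the actual list
  -- computation and not deduced from `listProduct≐`.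
  listProduct-monic : ∀ n {e acc} → (∀ d → 1 ≤ d → d ≤ n → Monic (totient d) (Φ d)) → Monic e acc →
    Monic (Sum.fold (suc n) (λ d → Sum.when (d ∣? N) (totient d)) + e) (listProduct acc (zipped n))
  listProduct-monic zero    {e} {acc} h m =
    subst (λ k → Monic (k + e) acc) (≡.sym (Sum.when-no (0 ∣? N) (m<n⇒n≢0 1≤N ∘ 0∣⇒≡0))) m
  listProduct-monic (suc n) {e} {acc} h m = ≡.subst₂ Monic
    (≡.sym (+-assoc (Sum.fold (suc n) (λ d → Sum.when (d ∣? N) (totient d))) _ e))
    (≡.sym (listProduct-suc acc n))
    (listProduct-monic n (λ d 1≤d d≤n → h d 1≤d (m≤n⇒m≤1+n d≤n))
      (step-monic (h (suc n) (s≤s z≤n) ≤-refl) m))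

-- The divisors are multiplied in one at a time: the next `Φ K` divides X^N - 1 itself and is
-- comaximal with the product of the earlier factors.
properPart-divides-X^N-1 : ∀ N → 1 ≤ N → (∀ d → 1 ≤ d → d < N → IsCyclotomic d) →
  ∀ K → K ≤ N → ∃ λ H → qPowMinusOne N ≐ H ⊗ Prod.fold K (λ d → Prod.when (d ∣? N) (Φ d))
properPart-divides-X^N-1 N 1≤N C = go
  where
  f : ℕ → Poly
  f d = Prod.when (d ∣? N) (Φ d)

  positive : ∀ {d} → d ∣ N → 1 ≤ d
  positive = divisor-positive 1≤N

  divides-X^N-1 : ∀ d → d < N → d ∣ N → ∃ λ H → qPowMinusOne N ≐ H ⊗ Φ d
  divides-X^N-1 d d<N d∣N@(divides e N≡ed) = geom (X ^ᵖ d) e ⊗ properPart d , (begin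
    qPowMinusOne N                                   ≈⟨ qPowMinusOne≐ N 1≤N ⟩
    X^n-1 N                                          ≡⟨ cong X^n-1 N≡ed ⟩
    X^n-1 (e * d)                                    ≈⟨ X^n-1-divides d e ⟩
    geom (X ^ᵖ d) e ⊗ X^n-1 d                        ≈⟨ ⊗-congˡ (geom (X ^ᵖ d) e) (≐-trans (≐-sym (qPowMinusOne≐ d 1≤d)) (≐-sym (properPart-⊗ (C d 1≤d d<N)))) ⟩
    geom (X ^ᵖ d) e ⊗ (properPart d ⊗ Φ d)           ≈⟨ ⊗-assoc (geom (X ^ᵖ d) e) (properPart d) (Φ d) ⟨
    geom (X ^ᵖ d) e ⊗ properPart d ⊗ Φ d             ∎)
    where
    open ≐-Reasoning
    1≤d = positive d∣N

  comaximal : ∀ j → j < N → 1 ≤ j → ∀ K → K ≤ j → Comaximal (Prod.fold K f) (Φ j)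
  comaximal j j<N 1≤j zero    _   = Comaximal-one (Φ j)
  comaximal j j<N 1≤j (suc i) i<j = Comaximal-⊗ (comaximal j j<N 1≤j i (<⇒≤ i<j)) term
    where
    i<N = <-trans i<j j<N
    term : Comaximal (f i) (Φ j)
    term with i ∣? N
    ... | no _    = Comaximal-one (Φ j)
    ... | yes i∣N = Comaximal-Φ i j (positive i∣N) i<j (C i (positive i∣N) i<N) (C j 1≤j j<N)
                      (λ g 1≤g g≤i → C g 1≤g (≤-<-trans g≤i i<N))

  times-one : ∀ p → p ≐ p ⊗ constant (+ 1)
  times-one p = ≐-sym (≐-trans (⊗-comm p (constant (+ 1))) (⊗-identityˡ p))

  go : ∀ K → K ≤ N → ∃ λ H → qPowMinusOne N ≐ H ⊗ Prod.fold K f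
  go zero    _   = qPowMinusOne N , times-one (qPowMinusOne N)
  go (suc K) K<N with go K (<⇒≤ K<N) | K ∣? N
  ... | H , e | no _    = H , ≐-trans e (⊗-congˡ H (times-one _))
  ... | H , e | yes K∣N = Comaximal-divide (comaximal K K<N (positive K∣N) K ≤-refl)
    (constant-term-Φ K (positive K∣N) (C K (positive K∣N) K<N)) (H , e) (divides-X^N-1 K K<N K∣N)

isCyclotomic-step : ∀ n → (∀ d → 1 ≤ d → d < suc n → IsCyclotomic d) → IsCyclotomic (suc n)
isCyclotomic-step n C = record
  { monic   = subst (Monic (totient N)) (≡.sym Φ≡b) b-monic
  ; product = product-Φ
  }
  where
  ≐-reflexive : ∀ {p q} → p ≡ q → p ≐ q
  ≐-reflexive ≡.refl = ≐-refl
  N = suc n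
  1≤N : 1 ≤ N
  1≤N = s≤s z≤n
  D = listProduct N 1≤N (constant (+ 1)) (zipped n)
  -- `cycloNext` takes its index range from the length of the list of predecessors, which has to be
  -- rewritten to `n`.
  D≡divisor : Φ N ≡ divMonic (qPowMinusOne N) D
  D≡divisor = cong (λ k → divMonic (qPowMinusOne N) (foldr _⊗_ (constant (+ 1))
      (map proj₂ (filter (λ dΦ → proj₁ dΦ ∣? N) (zip (map suc (upTo k)) (cycloList n))))))
    (length-cycloList n)
  D≐ : D ≐ properPart N
  D≐ = ≐-trans (listProduct≐ N 1≤N n (constant (+ 1)))
    (≐-trans (⊗-comm (properPart N) (constant (+ 1))) (⊗-identityˡ (properPart N)))
  d = Sum.fold N (λ k → Sum.when (k ∣? N) (totient k))
  D-monic : Monic d D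
  D-monic = subst (λ k → Monic k D) (+-identityʳ d)
    (listProduct-monic N 1≤N n (λ k 1≤k k≤n → monic (C k 1≤k (s≤s k≤n))) (≡.refl , ≡.refl))
  degrees : totient N + d ≡ N
  degrees = ≡.trans (+-comm (totient N) d)
    (≡.trans (≡.sym (Sum.foldDivisors-split N totient)) (gauss N 1≤N))
  cofactor = properPart-divides-X^N-1 N 1≤N C N ≤-refl
  H = proj₁ cofactor
  X^N-1≐HD : qPowMinusOne N ≐ H ⊗ D
  X^N-1≐HD = ≐-trans (proj₂ cofactor) (⊗-congˡ H (≐-sym D≐))
  H-bound : Bound (totient N) H
  H-bound = Bound-quotient (totient N) d H D-monic (Bound-resp X^N-1≐HD
    (Bound-length (qPowMinusOne N) (≤-reflexive (≡.trans (length-qPowMinusOne N 1≤N) (cong suc (≡.sym degrees))))))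
  -- The cofactor `H` may carry trailing zeros; exact division needs its representative of length
  -- `suc (totient N)`.
  normalized = withLength (totient N) H H-bound
  b = proj₁ normalized
  length-b : length b ≡ suc (totient N)
  length-b = proj₁ (proj₂ normalized)
  X^N-1≐bD : qPowMinusOne N ≐ b ⊗ D
  X^N-1≐bD = ≐-trans X^N-1≐HD (⊗-congʳ D (≐-sym (proj₂ (proj₂ normalized))))
  Φ≡b : Φ N ≡ b
  Φ≡b = ≡.trans D≡divisor (divMonic-exact (totient N) d (qPowMinusOne N) b D D-monic length-b
    (≡.trans (length-qPowMinusOne N 1≤N) (cong suc (≡.sym degrees))) X^N-1≐bD)
  leading-b : coeff (totient N) b ≡ + 1
  leading-b = begin
    coeff (totient N) b                           ≡⟨ ℤₚ.*-identityʳ _ ⟨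
    coeff (totient N) b ℤ.* + 1                   ≡⟨ cong (coeff (totient N) b ℤ.*_) (leading D-monic) ⟨
    coeff (totient N) b ℤ.* coeff d D             ≡⟨ coeff-⊗-top (totient N) d b D (Bound-length b (≤-reflexive length-b)) (Monic⇒Bound D-monic) ⟨
    coeff (totient N + d) (b ⊗ D)                 ≡⟨ at X^N-1≐bD (totient N + d) ⟨
    coeff (totient N + d) (qPowMinusOne N)        ≡⟨ cong (λ k → coeff k (qPowMinusOne N)) degrees ⟩
    coeff N (qPowMinusOne N)                      ≡⟨ leading-qPowMinusOne N 1≤N ⟩
    + 1                                           ∎
    where open ≡-Reasoning
  b-monic : Monic (totient N) b
  b-monic = length-b , leading-b
  product-Φ : Prod.foldDivisors N Φ ≐ qPowMinusOne N
  product-Φ = begin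
    Prod.foldDivisors N Φ          ≈⟨ Prod.foldDivisors-split N Φ ⟩
    properPart N ⊗ Φ N             ≈⟨ ⊗-cong (≐-sym D≐) (≐-reflexive Φ≡b) ⟩
    D ⊗ b                          ≈⟨ ⊗-comm D b ⟩
    b ⊗ D                          ≈⟨ X^N-1≐bD ⟨
    qPowMinusOne N                 ∎
    where open ≐-Reasoning

isCyclotomic : ∀ N → 1 ≤ N → IsCyclotomic N
isCyclotomic N 1≤N = below (suc N) N 1≤N ≤-refl
  where
  below : ∀ K N → 1 ≤ N → N < K → IsCyclotomic N
  below (suc K) (suc n) _ N<K = isCyclotomic-step n
    λ d 1≤d d<N → below K d 1≤d (<-≤-trans d<N (s≤s⁻¹ N<K))

-- Palindromicity and the substitution q ↦ qᵖ

monic-Φ : ∀ d → Monic (totient d) (Φ d)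
-- The dummy value `Φ 0` is the constant 1, in accordance with `totient 0` being 0.
monic-Φ zero    = ≡.refl , ≡.refl
monic-Φ (suc d) = monic (isCyclotomic (suc d) (s≤s z≤n))

bound-Φ : ∀ d → Bound (totient d) (Φ d)
bound-Φ d = Monic⇒Bound (monic-Φ d)

module CyclotomicProduct {c ℓ} (R : CommutativeRing c ℓ) (x y : CommutativeRing.Carrier R) where
  open RingNotation R
  open IntegerImage R
  open Homogenization R x y
  open ≈-Reasoning
  module RProd = RangeFold (CommutativeRing.*-commutativeMonoid R)

  homogΦ : ℕ → Carrier
  homogΦ d = homog (totient d) (Φ d)

  module _ (N : ℕ) where

    private
      δ : ℕ → ℕ
      δ d = Sum.when (d ∣? N) (totient d)

      f : ℕ → Poly
      f d = Prod.when (d ∣? N) (Φ d)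

    bound-factor : ∀ d → Bound (δ d) (f d)
    bound-factor d with d ∣? N
    ... | yes _ = bound-Φ d
    ... | no _  = Bound-length (constant (+ 1)) ≤-refl

    bound-product : ∀ K → Bound (Sum.fold K δ) (Prod.fold K f)
    bound-product zero    = Bound-length (constant (+ 1)) ≤-refl
    bound-product (suc K) = Bound-⊗ _ _ (Prod.fold K f) (f K) (bound-product K) (bound-factor K)

    homog-factor : ∀ d → homog (δ d) (f d) ≈ RProd.when (d ∣? N) (homogΦ d)
    homog-factor d with d ∣? N
    ... | yes _ = refl
    ... | no _  = fromℤR-one

    homog-product : ∀ K → homog (Sum.fold K δ) (Prod.fold K f) ≈
                          RProd.fold K (λ d → RProd.when (d ∣? N) (homogΦ d))
    homog-product zero    = fromℤR-one
    homog-product (suc K) = trans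
      (homog-⊗ (Sum.fold K δ) (δ K) (Prod.fold K f) (f K) (bound-product K) (bound-factor K))
      (·-cong (homog-product K) (homog-factor K))

  homog-qPowMinusOne : ∀ N → 1 ≤ N → homog N (qPowMinusOne N) ≈ x ^^ N ⊞ ⊟ (y ^^ N)
  homog-qPowMinusOne N 1≤N = begin
    homog N (qPowMinusOne N)                                    ≈⟨ homog-cong N (≐-trans (qPowMinusOne≐ N 1≤N) (⊕-cong (X^≐shift N) ≐-refl)) ⟩
    homog N (shift N (constant (+ 1)) ⊕ constant -[1+ 0 ])      ≈⟨ homog-⊕ N (shift N (constant (+ 1))) _ ⟩
    homog N (shift N (constant (+ 1))) ⊞ homog N (constant -[1+ 0 ])
                                                                ≈⟨ ⊞-cong (homog-monomial N) (homog-constant N -[1+ 0 ]) ⟩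
    x ^^ N ⊞ ⊟ (1# ⊞ 0#) · y ^^ N                               ≈⟨ ⊞-congˡ (·-congʳ (⊟-cong (⊞-identityʳ 1#))) ⟩
    x ^^ N ⊞ ⊟ 1# · y ^^ N                                      ≈⟨ ⊞-congˡ (⊟-distribˡ-· 1# (y ^^ N)) ⟨
    x ^^ N ⊞ ⊟ (1# · y ^^ N)                                    ≈⟨ ⊞-congˡ (⊟-cong (·-identityˡ (y ^^ N))) ⟩
    x ^^ N ⊞ ⊟ (y ^^ N)                                         ∎

  -- The product formula homogenized factor by factor; by `gauss` the degrees of the factors add up
  -- to exactly N. The pair (1, q) gives the reversed polynomials, and (q^p, 1) those with q
  -- replaced by q^p.
  homogΦ-product : ∀ N → 1 ≤ N → RProd.foldDivisors N homogΦ ≈ x ^^ N ⊞ ⊟ (y ^^ N)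
  homogΦ-product N 1≤N = begin
    RProd.foldDivisors N homogΦ                                 ≈⟨ homog-product N (suc N) ⟨
    homog (Sum.foldDivisors N totient) (Prod.foldDivisors N Φ)  ≡⟨ cong (λ n → homog n (Prod.foldDivisors N Φ)) (gauss N 1≤N) ⟩
    homog N (Prod.foldDivisors N Φ)                             ≈⟨ homog-cong N (product (isCyclotomic N 1≤N)) ⟩
    homog N (qPowMinusOne N)                                    ≈⟨ homog-qPowMinusOne N 1≤N ⟩
    x ^^ N ⊞ ⊟ (y ^^ N)                                         ∎

nonzero-fold : ∀ K (f : ℕ → Poly) → (∀ d → d < K → coeff 0 (f d) ≢ + 0) → coeff 0 (Prod.fold K f) ≢ + 0
nonzero-fold zero    f h = λ ()
nonzero-fold (suc K) f h e = [ nonzero-fold K f (λ d d<K → h d (m<n⇒m<1+n d<K)) , h K ≤-refl ]′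
  (ℤₚ.i*j≡0⇒i≡0∨j≡0 _ (≡.trans (≡.sym (coeff-⊗-zero (Prod.fold K f) (f K))) e))

nonzero-when : {P : Set} (d : Dec P) {p : Poly} → coeff 0 p ≢ + 0 → coeff 0 (Prod.when d p) ≢ + 0
nonzero-when (yes _) h = h
nonzero-when (no _)  h = λ ()

nonzero-Φ : ∀ d → coeff 0 (Φ d) ≢ + 0
nonzero-Φ zero    = λ ()
nonzero-Φ (suc d) = IsUnit⇒≢0 (constant-term-Φ (suc d) (s≤s z≤n) (isCyclotomic (suc d) (s≤s z≤n)))

foldDivisors-unique-poly : ∀ {f g} → (∀ d → coeff 0 (g d) ≢ + 0) →
  (∀ N → 1 ≤ N → Prod.foldDivisors N f ≐ Prod.foldDivisors N g) → ∀ N → 1 ≤ N → f N ≐ g N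
foldDivisors-unique-poly {f} {g} g₀≢0 = Prod.foldDivisors-unique λ N 1≤N p q e →
  let P = Prod.fold N (λ d → Prod.when (d ∣? N) (g d)) in
  ⊗-cancelʳ (nonzero-fold N _ λ d _ → nonzero-when (d ∣? N) (g₀≢0 d)) p q
    (≐-trans (⊗-comm p P) (≐-trans e (⊗-comm P q)))

-- Reversal turns the product X^N - 1 of the Φ_d into 1 - X^N; the sign is absorbed by Φ₁.
module _ where
  open CyclotomicProduct polyRing (constant (+ 1)) X using (homogΦ; homogΦ-product)
  open ≐-Reasoning

  private
    sign : ℕ → Poly
    sign 1 = ⊖ constant (+ 1)
    sign _ = constant (+ 1)

    sign-trivial : ∀ {N} d → d ≢ 1 → Prod.when (d ∣? N) (sign d) ≐ constant (+ 1)
    sign-trivial {N} 0             _   with 0 ∣? N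
    ... | yes _ = ≐-refl
    ... | no _  = ≐-refl
    sign-trivial     1             1≢1 = contradiction ≡.refl 1≢1
    sign-trivial {N} (suc (suc d)) _   with suc (suc d) ∣? N
    ... | yes _ = ≐-refl
    ... | no _  = ≐-refl

    sign-product : ∀ N → 1 ≤ N → Prod.foldDivisors N sign ≐ ⊖ constant (+ 1)
    sign-product N 1≤N = ≐-trans
      (Prod.fold-single 1 (s≤s 1≤N) λ d _ → sign-trivial d)
      (Prod.when-yes (1 ∣? N) (1∣ N))

    reversed-product : ∀ N → 1 ≤ N →
      Prod.foldDivisors N (λ d → sign d ⊗ homogΦ d) ≐ Prod.foldDivisors N Φ
    reversed-product N 1≤N = begin
      Prod.foldDivisors N (λ d → sign d ⊗ homogΦ d)                   ≈⟨ Prod.foldDivisors-∙ N sign homogΦ ⟩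
      Prod.foldDivisors N sign ⊗ Prod.foldDivisors N homogΦ           ≈⟨ ⊗-cong (sign-product N 1≤N) (homogΦ-product N 1≤N) ⟩
      ⊖ constant (+ 1) ⊗ (constant (+ 1) ^ᵖ N ⊕ ⊖ (X ^ᵖ N))           ≈⟨ ⊗-congˡ (⊖ constant (+ 1)) (⊕-cong (Poly-Powers.1^^ N) ≐-refl) ⟩
      ⊖ constant (+ 1) ⊗ (constant (+ 1) ⊕ ⊖ (X ^ᵖ N))                ≈⟨ negate (X ^ᵖ N) ⟩
      X^n-1 N                                                         ≈⟨ qPowMinusOne≐ N 1≤N ⟨
      qPowMinusOne N                                                  ≈⟨ product (isCyclotomic N 1≤N) ⟨
      Prod.foldDivisors N Φ                                           ∎
      where
      negate : ∀ z → ⊖ constant (+ 1) ⊗ (constant (+ 1) ⊕ ⊖ z) ≐ z ⊕ ⊖ constant (+ 1)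
      negate = Negation.minus-minus polyRing

  palindromic-Φ : ∀ N → 2 ≤ N → reversal (totient N) (Φ N) ≐ Φ N
  palindromic-Φ 1             (s≤s ())
  -- From index 2 on `sign` is 1, so uniqueness speaks of the reversal itself.
  palindromic-Φ (suc (suc N)) _ = ≐-trans (≐-sym (⊗-identityˡ _))
    (foldDivisors-unique-poly {g = Φ} nonzero-Φ reversed-product (suc (suc N)) (s≤s z≤n))

module _ (p : ℕ) (p-prime : Prime p) where
  open CyclotomicProduct polyRing (X ^ᵖ p) (constant (+ 1)) using (homogΦ; homogΦ-product)
  open ≐-Reasoning

  private
    Φ∤ : ℕ → Poly
    Φ∤ d = Prod.when (¬? (p ∣? d)) (Φ d)

    totient∤ : ℕ → ℕ
    totient∤ d = Sum.when (¬? (p ∣? d)) (totient d)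

    substituted-product : ∀ N → 1 ≤ N →
      Prod.foldDivisors N homogΦ ≐ Prod.foldDivisors N (λ d → Φ (d * p) ⊗ Φ∤ d)
    substituted-product N 1≤N = begin
      Prod.foldDivisors N homogΦ                                ≈⟨ homogΦ-product N 1≤N ⟩
      (X ^ᵖ p) ^ᵖ N ⊕ ⊖ (constant (+ 1) ^ᵖ N)                   ≈⟨ ⊕-cong (^ᵖ-*-comm p N) (scale-cong (ℤ.- (+ 1)) (Poly-Powers.1^^ N)) ⟩
      X^n-1 (N * p)                                             ≈⟨ qPowMinusOne≐ (N * p) 1≤Np ⟨
      qPowMinusOne (N * p)                                      ≈⟨ product (isCyclotomic (N * p) 1≤Np) ⟨
      Prod.foldDivisors (N * p) Φ                               ≈⟨ Prod.foldDivisors-*-prime p N Φ p-prime 1≤N ⟩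
      Prod.foldDivisors N (λ d → Φ (d * p) ⊗ Φ∤ d)              ∎
      where
      1≤Np : 1 ≤ N * p
      1≤Np = *-mono-≤ 1≤N (ℕ.>-nonZero⁻¹ p {{prime⇒nonZero p-prime}})

    totient-sum : ∀ N → 1 ≤ N →
      Sum.foldDivisors N (λ d → totient d * p) ≡ Sum.foldDivisors N (λ d → totient (d * p) + totient∤ d)
    totient-sum N 1≤N = R.begin
      Sum.foldDivisors N (λ d → totient d * p)                     R.≡⟨ scaled (suc N) ⟩
      Sum.foldDivisors N totient * p                               R.≡⟨ cong (_* p) (gauss N 1≤N) ⟩
      N * p                                                        R.≡⟨ gauss (N * p) (*-mono-≤ 1≤N (ℕ.>-nonZero⁻¹ p {{prime⇒nonZero p-prime}})) ⟨
      Sum.foldDivisors (N * p) totient                             R.≡⟨ Sum.foldDivisors-*-prime p N totient p-prime 1≤N ⟩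
      Sum.foldDivisors N (λ d → totient (d * p) + totient∤ d)      R.∎
      where
      module R = ≡-Reasoning
      when-* : {P : Set} (e : Dec P) (m : ℕ) → Sum.when e (m * p) ≡ Sum.when e m * p
      when-* (yes _) m = ≡.refl
      when-* (no _)  m = ≡.refl
      scaled : ∀ K → Sum.fold K (λ d → Sum.when (d ∣? N) (totient d * p)) ≡
                     Sum.fold K (λ d → Sum.when (d ∣? N) (totient d)) * p
      scaled zero    = ≡.refl
      scaled (suc K) = ≡.trans (cong₂ _+_ (scaled K) (when-* (K ∣? N) (totient K)))
        (≡.sym (*-distribʳ-+ p (Sum.fold K (λ d → Sum.when (d ∣? N) (totient d))) _))

  -- Over the divisors of N both sides multiply to q^(Np) - 1: on the left by substituting in q^N -
  -- 1, on the right by sorting the divisors of N p.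
  substitution-Φ : ∀ N → 1 ≤ N → Substitution.homog p (totient N) (Φ N) ≐ Φ (N * p) ⊗ Φ∤ N
  substitution-Φ = foldDivisors-unique-poly {f = homogΦ}
    (λ d → λ e → [ nonzero-Φ (d * p) , nonzero-when (¬? (p ∣? d)) (nonzero-Φ d) ]′
      (ℤₚ.i*j≡0⇒i≡0∨j≡0 _ (≡.trans (≡.sym (coeff-⊗-zero (Φ (d * p)) (Φ∤ d))) e)))
    substituted-product

  -- The same argument in the additive monoid ℕ; it supplies the degrees that belong to
  -- `substitution-Φ`.
  totient-*-prime : ∀ N → 1 ≤ N → totient N * p ≡ totient (N * p) + totient∤ N
  totient-*-prime = Sum.foldDivisors-unique
    (λ N _ x y → +-cancelˡ-≡ (Sum.fold N (λ d → Sum.when (d ∣? N) (totient (d * p) + totient∤ d))) x y)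
    totient-sum

  substitution-Φ-∣ : ∀ N → 1 ≤ N → p ∣ N → Substitution.homog p (totient N) (Φ N) ≐ Φ (N * p)
  substitution-Φ-∣ N 1≤N p∣N = begin
    Substitution.homog p (totient N) (Φ N)      ≈⟨ substitution-Φ N 1≤N ⟩
    Φ (N * p) ⊗ Φ∤ N                            ≈⟨ ⊗-congˡ (Φ (N * p)) (Prod.when-no (¬? (p ∣? N)) (λ p∤N → p∤N p∣N)) ⟩
    Φ (N * p) ⊗ constant (+ 1)                  ≈⟨ ⊗-comm (Φ (N * p)) (constant (+ 1)) ⟩
    constant (+ 1) ⊗ Φ (N * p)                  ≈⟨ ⊗-identityˡ (Φ (N * p)) ⟩
    Φ (N * p)                                   ∎

  totient-*-∣ : ∀ N → 1 ≤ N → p ∣ N → totient (N * p) ≡ totient N * p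
  totient-*-∣ N 1≤N p∣N = ≡.sym (≡.trans (totient-*-prime N 1≤N)
    (≡.trans (cong (_+_ (totient (N * p))) (Sum.when-no (¬? (p ∣? N)) (λ p∤N → p∤N p∣N))) (+-identityʳ _)))

  substitution-Φ-∤ : ∀ N → 1 ≤ N → ¬ p ∣ N →
                     Substitution.homog p (totient N) (Φ N) ≐ Φ (N * p) ⊗ Φ N
  substitution-Φ-∤ N 1≤N p∤N = ≐-trans (substitution-Φ N 1≤N)
    (⊗-congˡ (Φ (N * p)) (Prod.when-yes (¬? (p ∣? N)) p∤N))

  totient-*-∤ : ∀ N → 1 ≤ N → ¬ p ∣ N → totient N * p ≡ totient (N * p) + totient N
  totient-*-∤ N 1≤N p∤N = ≡.trans (totient-*-prime N 1≤N)
    (cong (_+_ (totient (N * p))) (Sum.when-yes (¬? (p ∣? N)) p∤N))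

-- Evaluation of Lucas atoms

module Composition {c ℓ} (R : CommutativeRing c ℓ) (x y : CommutativeRing.Carrier R) (k : ℕ) where
  open RingNotation R
  open RingPowers R
  open Homogenization R x y
  open ≈-Reasoning
  private
    module S  = Substitution k
    module Rₖ = Homogenization R (x ^^ k) (y ^^ k)

    head≐ : ∀ z m → fromℤR polyRing z ⊗ constant (+ 1) ^ᵖ m ≐ constant z
    head≐ z m = ≐-trans (⊗-cong (fromℤR-poly z) (Poly-Powers.1^^ m))
      (≐-trans (⊗-comm (constant z) (constant (+ 1))) (⊗-identityˡ (constant z)))

    bound-X^ : Bound k (X ^ᵖ k)
    bound-X^ = Bound-resp (≐-sym (X^≐shift k)) (subst (λ n → Bound n (shift k (constant (+ 1)))) (+-identityʳ k)
      (Bound-shift k (constant (+ 1)) (Bound-length (constant (+ 1)) ≤-refl)))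

    bound-substitution : ∀ n f → Bound (n * k) (S.homogSeq n f)
    bound-substitution zero    f = Bound-resp (≐-sym (fromℤR-poly (f 0))) (Bound-length (constant (f 0)) ≤-refl)
    bound-substitution (suc n) f = Bound-⊕ (fromℤR polyRing (f 0) ⊗ constant (+ 1) ^ᵖ suc n) _
      (Bound-resp (≐-sym (head≐ (f 0) (suc n)))
        (Bound-mono {0} {suc n * k} {constant (f 0)} z≤n (Bound-length (constant (f 0)) ≤-refl)))
      (Bound-⊗ k (n * k) (X ^ᵖ k) (S.homogSeq n (f ∘ suc)) bound-X^ (bound-substitution n (f ∘ suc)))

    homogSeq-substitution : ∀ n f → homog (n * k) (S.homogSeq n f) ≈ Rₖ.homogSeq n f
    homogSeq-substitution zero    f = homog-cong 0 (fromℤR-poly (f 0))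
    homogSeq-substitution (suc n) f = begin
      homog (suc n * k) (A ⊕ X ^ᵖ k ⊗ B)
        ≈⟨ homog-⊕ (suc n * k) A (X ^ᵖ k ⊗ B) ⟩
      homog (suc n * k) A ⊞ homog (k + n * k) (X ^ᵖ k ⊗ B)
        ≈⟨ ⊞-cong (trans (homog-cong (suc n * k) (head≐ (f 0) (suc n))) (homog-constant (suc n * k) (f 0)))
                  (homog-⊗ k (n * k) (X ^ᵖ k) B bound-X^ (bound-substitution n (f ∘ suc))) ⟩
      ⟦ f 0 ⟧ · y ^^ (suc n * k) ⊞ homog k (X ^ᵖ k) · homog (n * k) B
        ≈⟨ ⊞-cong (·-congˡ (^^-* y (suc n) k))
                  (·-cong (trans (homog-cong k (X^≐shift k)) (homog-monomial k)) (homogSeq-substitution n (f ∘ suc))) ⟩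
      ⟦ f 0 ⟧ · (y ^^ k) ^^ suc n ⊞ x ^^ k · Rₖ.homogSeq n (f ∘ suc)
        ∎
      where
      A = fromℤR polyRing (f 0) ⊗ constant (+ 1) ^ᵖ suc n
      B = S.homogSeq n (f ∘ suc)

  -- Substituting q^k multiplies the degree by `k`, and homogenizing q^k in degree `k` gives
  -- `x ^^ k`; the missing powers of `y` likewise come in multiples of `k`.
  homog-substitution : ∀ n p → homog (n * k) (S.homog n p) ≈ Rₖ.homog n p
  homog-substitution n p = homogSeq-substitution n (λ i → coeff i p)

-- Peeling off the coefficients γ_j

summand : ℕ → ℕ → Poly
summand φn j = shift j (ppow onePlusQ (φn ∸ (j + j)))

peel : ℕ → ℕ → Poly → Poly
peel φn j r = r ⊕ scale (ℤ.- coeff j r) (summand φn j)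

-- What `gammaLoop` leaves behind after `c` rounds; the recursion follows that of the loop.
remainder : ℕ → ℕ → ℕ → Poly → Poly
remainder φn zero    j r = r
remainder φn (suc c) j r = remainder φn c (suc j) (peel φn j r)

-- Keeps the truncated subtraction `φn ∸ (j + j)` exact at every index that the loop visits.
InRange : ℕ → ℕ → ℕ → Set
InRange φn c j = ∀ i → i < c → (j + i) + (j + i) ≤ φn

InRange-head : ∀ {φn c} j → InRange φn (suc c) j → j + j ≤ φn
InRange-head {φn} j h = subst (λ k → k + k ≤ φn) (+-identityʳ j) (h 0 (s≤s z≤n))

InRange-tail : ∀ {φn c j} → InRange φn (suc c) j → InRange φn c (suc j)
InRange-tail {φn} {j = j} h i i<c = subst (λ k → k + k ≤ φn) (+-suc j i) (h (suc i) (s≤s i<c))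

record Roots {c ℓ} (R : CommutativeRing c ℓ) (x y s t : CommutativeRing.Carrier R) : Set ℓ where
  constructor _,_
  open RingNotation R
  field
    vieta-sum     : s ≈ x ⊞ y
    vieta-product : ⊟ t ≈ x · y

module LucasEvaluation {c ℓ} (R : CommutativeRing c ℓ) {x y s t : CommutativeRing.Carrier R}
  (roots : Roots R x y s t) where
  open RingNotation R
  open RingPowers R
  open IntegerImage R
  open Homogenization R x y
  open ≈-Reasoning
  open IntegerSolver R
  open Roots roots

  homog-summand : ∀ φn j → j + j ≤ φn → homog φn (summand φn j) ≈ s ^^ (φn ∸ (j + j)) · (⊟ t) ^^ j
  homog-summand φn j 2j≤φ = begin
    homog φn (shift j q)                ≡⟨ cong (λ n → homog n (shift j q)) φ≡ ⟩
    homog (j + (k + j)) (shift j q)     ≈⟨ homog-shift j (k + j) q ⟩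
    x ^^ j · homog (k + j) q            ≈⟨ ·-congˡ (homog-degree k j q (Bound-ppow-onePlusQ k)) ⟩
    x ^^ j · (y ^^ j · homog k q)       ≈⟨ ·-congˡ (·-congˡ (trans (homog-onePlusQ^ k) (^^-cong k (sym vieta-sum)))) ⟩
    x ^^ j · (y ^^ j · s ^^ k)          ≈⟨ solve 3 (λ a b c → a :* (b :* c) := c :* (a :* b)) refl (x ^^ j) (y ^^ j) (s ^^ k) ⟩
    s ^^ k · (x ^^ j · y ^^ j)          ≈⟨ ·-congˡ (trans (sym (·-^^ x y j)) (^^-cong j (sym vieta-product))) ⟩
    s ^^ k · (⊟ t) ^^ j                 ∎
    where
    k = φn ∸ (j + j)
    q = ppow onePlusQ k
    φ≡ : φn ≡ j + (k + j)
    φ≡ = ≡.trans (≡.sym (m∸n+n≡m 2j≤φ)) (≡.trans (≡.sym (+-assoc k j j)) (+-comm (k + j) j))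

  -- Each round moves one multiple of a summand from the polynomial into the Lucas sum, leaving the
  -- total unchanged.
  lucasSum-homog : ∀ φn c j r → InRange φn c j →
    homog φn r ≈ lucasSum R φn j (gammaLoop φn c j r) s t ⊞ homog φn (remainder φn c j r)
  lucasSum-homog φn zero    j r h = sym (⊞-identityˡ _)
  lucasSum-homog φn (suc c) j r h = begin
    homog φn r
      ≈⟨ solve 3 (λ u γ w → u := γ :* w :+ (u :+ (:- γ) :* w)) refl (homog φn r) ⟦ γ ⟧ W ⟩
    ⟦ γ ⟧ · W ⊞ (homog φn r ⊞ ⊟ ⟦ γ ⟧ · W)
      ≈⟨ ⊞-cong (trans (·-congˡ (homog-summand φn j (InRange-head j h))) (sym (·-assoc _ _ _))) (sym peeled) ⟩
    ⟦ γ ⟧ · s ^^ (φn ∸ (j + j)) · (⊟ t) ^^ j ⊞ homog φn r′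
      ≈⟨ ⊞-congˡ (lucasSum-homog φn c (suc j) r′ (InRange-tail h)) ⟩
    ⟦ γ ⟧ · s ^^ (φn ∸ (j + j)) · (⊟ t) ^^ j ⊞ (L ⊞ homog φn (remainder φn c (suc j) r′))
      ≈⟨ ⊞-assoc _ _ _ ⟨
    lucasSum R φn j (gammaLoop φn (suc c) j r) s t ⊞ homog φn (remainder φn (suc c) j r)
      ∎
    where
    γ  = coeff j r
    r′ = peel φn j r
    W  = homog φn (summand φn j)
    L  = lucasSum R φn (suc j) (gammaLoop φn c (suc j) r′) s t
    peeled : homog φn r′ ≈ homog φn r ⊞ ⊟ ⟦ γ ⟧ · W
    peeled = trans (homog-⊕ φn r (scale (ℤ.- γ) (summand φn j)))
      (⊞-congˡ (trans (homog-scale φn (ℤ.- γ) (summand φn j)) (·-congʳ (fromℤR-neg γ))))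

-- Palindromic polynomials and the vanishing of the remainder

record Palindromic (n : ℕ) (p : Poly) : Set where
  constructor palindromic
  field
    bound    : Bound n p
    reversed : reversal n p ≐ p

ppow≡ : ∀ p k → ppow p k ≡ p ^ᵖ k
ppow≡ p zero    = ≡.refl
ppow≡ p (suc k) = cong (p ⊗_) (ppow≡ p k)

module _ (φn j : ℕ) (2j≤φ : j + j ≤ φn) where
  private
    k = φn ∸ (j + j)

  Bound-summand : Bound φn (summand φn j)
  Bound-summand = Bound-mono {p = summand φn j}
    (≤-trans (≤-reflexive (+-comm j k)) (≤-trans (+-monoʳ-≤ k (m≤n+m j j)) (≤-reflexive (m∸n+n≡m 2j≤φ))))
    (Bound-shift j (ppow onePlusQ k) (Bound-ppow-onePlusQ k))

  -- Reversal is homogenization at (1, q), a pair with sum 1 + q and product q. With these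
  -- parameters `homog-summand` returns the summand itself.
  reversal-summand : reversal φn (summand φn j) ≐ summand φn j
  reversal-summand = begin
    reversal φn (summand φn j)                            ≈⟨ LucasEvaluation.homog-summand polyRing {constant (+ 1)} {X} {onePlusQ} {⊖ X}
                                                               (≐-refl , ∷-cong ≡.refl (∷-cong ≡.refl ≐-refl)) φn j 2j≤φ ⟩
    onePlusQ ^ᵖ k ⊗ (⊖ ⊖ X) ^ᵖ j                          ≈⟨ ⊗-comm (onePlusQ ^ᵖ k) ((⊖ ⊖ X) ^ᵖ j) ⟩
    -- `⊖ ⊖ X` computes to `X`.
    X ^ᵖ j ⊗ onePlusQ ^ᵖ k                                ≡⟨ cong (X ^ᵖ j ⊗_) (ppow≡ onePlusQ k) ⟨
    X ^ᵖ j ⊗ ppow onePlusQ k                              ≈⟨ shift-X j (ppow onePlusQ k) ⟨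
    summand φn j                                          ∎
    where open ≐-Reasoning

  Palindromic-peel : ∀ r → Palindromic φn r → Palindromic φn (peel φn j r)
  Palindromic-peel r (palindromic b e) = palindromic
    (Bound-⊕ r (scale z (summand φn j)) b (Bound-scale z (summand φn j) Bound-summand))
    (begin
      reversal φn (peel φn j r)                                           ≈⟨ Reversal.homog-⊕ φn r _ ⟩
      reversal φn r ⊕ reversal φn (scale z (summand φn j))                ≈⟨ ⊕-cong e (Reversal.homog-scale φn z (summand φn j)) ⟩
      r ⊕ fromℤR polyRing z ⊗ reversal φn (summand φn j)                  ≈⟨ ⊕-cong (≐-refl {r}) (⊗-cong (fromℤR-poly z) reversal-summand) ⟩
      r ⊕ constant z ⊗ summand φn j                                       ≈⟨ ⊕-cong (≐-refl {r}) (constant-⊗ z (summand φn j)) ⟩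
      peel φn j r                                                         ∎)
    where
    open ≐-Reasoning
    z = ℤ.- coeff j r

coeff-shift-low : ∀ k p i → i < k → coeff i (shift k p) ≡ + 0
coeff-shift-low (suc k) p zero    _         = ≡.refl
coeff-shift-low (suc k) p (suc i) (s≤s i<k) = coeff-shift-low k p i i<k

coeff-shift : ∀ k p → coeff k (shift k p) ≡ coeff 0 p
coeff-shift zero    p = ≡.refl
coeff-shift (suc k) p = coeff-shift k p

coeff-ppow-zero : ∀ k → coeff 0 (ppow onePlusQ k) ≡ + 1
coeff-ppow-zero zero    = ≡.refl
coeff-ppow-zero (suc k) = ≡.trans (coeff-⊗-zero onePlusQ (ppow onePlusQ k))
  (≡.trans (ℤₚ.*-identityˡ _) (coeff-ppow-zero k))

-- The summand starts with q^j with coefficient 1, so peeling clears coefficient `j` and leaves the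
-- lower ones alone.
coeff-peel-low : ∀ φn j r → (∀ i → i < j → coeff i r ≡ + 0) →
                 ∀ i → i < suc j → coeff i (peel φn j r) ≡ + 0
coeff-peel-low φn j r low i i<1+j = ≡.trans (coeff-⊕ r _ i)
  (≡.trans (cong (λ z → coeff i r ℤ.+ z) (coeff-scale (ℤ.- coeff j r) (summand φn j) i))
           (cases (m≤n⇒m<n∨m≡n (s≤s⁻¹ i<1+j))))
  where
  cases : i < j ⊎ i ≡ j → coeff i r ℤ.+ ℤ.- coeff j r ℤ.* coeff i (summand φn j) ≡ + 0
  cases (inj₁ i<j) = cong₂ ℤ._+_ (low i i<j)
    (≡.trans (cong (ℤ.- coeff j r ℤ.*_) (coeff-shift-low j _ i i<j)) (ℤₚ.*-zeroʳ (ℤ.- coeff j r)))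
  cases (inj₂ ≡.refl) = ≡.trans
    (cong (λ z → coeff j r ℤ.+ ℤ.- coeff j r ℤ.* z)
      (≡.trans (coeff-shift j (ppow onePlusQ (φn ∸ (j + j)))) (coeff-ppow-zero (φn ∸ (j + j)))))
    (≡.trans (cong (λ z → coeff j r ℤ.+ z) (ℤₚ.*-identityʳ _)) (ℤₚ.+-inverseʳ (coeff j r)))

Palindromic-remainder : ∀ φn c j r → InRange φn c j → Palindromic φn r →
                        Palindromic φn (remainder φn c j r)
Palindromic-remainder φn zero    j r h pal = pal
Palindromic-remainder φn (suc c) j r h pal = Palindromic-remainder φn c (suc j) (peel φn j r)
  (InRange-tail h) (Palindromic-peel φn j (InRange-head j h) r pal)

coeff-remainder-low : ∀ φn c j r → (∀ i → i < j → coeff i r ≡ + 0) →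
                      ∀ i → i < j + c → coeff i (remainder φn c j r) ≡ + 0
coeff-remainder-low φn zero    j r low i i<j   = low i (subst (i <_) (+-identityʳ j) i<j)
coeff-remainder-low φn (suc c) j r low i i<j+c = coeff-remainder-low φn c (suc j) (peel φn j r)
  (coeff-peel-low φn j r low) i (subst (i <_) (+-suc j c) i<j+c)

module _ where
  open Reversal using (homogSeq)
  open ≡-Reasoning

  private
    top : ∀ n f → homogSeq (suc n) f ≐ shift (suc n) (constant (f 0)) ⊕ homogSeq n (f ∘ suc)
    top n f = ⊕-cong (≐-trans (⊗-congʳ (X ^ᵖ suc n) (fromℤR-poly (f 0)))
        (≐-trans (⊗-comm (constant (f 0)) (X ^ᵖ suc n)) (≐-sym (shift-X (suc n) (constant (f 0))))))
      (⊗-identityˡ (homogSeq n (f ∘ suc)))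

  Bound-reversalSeq : ∀ n f → Bound n (homogSeq n f)
  Bound-reversalSeq zero    f = Bound-resp (≐-sym (fromℤR-poly (f 0))) (Bound-length (constant (f 0)) ≤-refl)
  Bound-reversalSeq (suc n) f = Bound-resp (≐-sym (top n f))
    (Bound-⊕ (shift (suc n) (constant (f 0))) (homogSeq n (f ∘ suc))
      (subst (λ k → Bound k (shift (suc n) (constant (f 0)))) (+-identityʳ (suc n))
        (Bound-shift (suc n) (constant (f 0)) (Bound-length (constant (f 0)) ≤-refl)))
      (Bound-mono {p = homogSeq n (f ∘ suc)} (n≤1+n n) (Bound-reversalSeq n (f ∘ suc))))

  coeff-reversalSeq : ∀ n f i → i ≤ n → coeff i (homogSeq n f) ≡ f (n ∸ i)
  coeff-reversalSeq zero    f zero _   = at (fromℤR-poly (f 0)) 0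
  coeff-reversalSeq (suc n) f i    i≤n = begin
    coeff i (homogSeq (suc n) f)                           ≡⟨ at (top n f) i ⟩
    coeff i (shift (suc n) (constant (f 0)) ⊕ rest)        ≡⟨ coeff-⊕ (shift (suc n) (constant (f 0))) rest i ⟩
    coeff i (shift (suc n) (constant (f 0))) ℤ.+ coeff i rest
                                                           ≡⟨ cases (m≤n⇒m<n∨m≡n i≤n) ⟩
    f (suc n ∸ i)                                          ∎
    where
    rest = homogSeq n (f ∘ suc)
    cases : i < suc n ⊎ i ≡ suc n →
            coeff i (shift (suc n) (constant (f 0))) ℤ.+ coeff i rest ≡ f (suc n ∸ i)
    cases (inj₁ i<1+n) = begin
      coeff i (shift (suc n) (constant (f 0))) ℤ.+ coeff i rest   ≡⟨ cong₂ ℤ._+_ (coeff-shift-low (suc n) _ i i<1+n) (coeff-reversalSeq n (f ∘ suc) i (s≤s⁻¹ i<1+n)) ⟩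
      + 0 ℤ.+ f (suc (n ∸ i))                                     ≡⟨ ℤₚ.+-identityˡ _ ⟩
      f (suc (n ∸ i))                                             ≡⟨ cong f (+-∸-assoc 1 (s≤s⁻¹ i<1+n)) ⟨
      f (suc n ∸ i)                                               ∎
    cases (inj₂ ≡.refl) = begin
      coeff (suc n) (shift (suc n) (constant (f 0))) ℤ.+ coeff (suc n) rest   ≡⟨ cong₂ ℤ._+_ (coeff-shift (suc n) _) (Bound-reversalSeq n (f ∘ suc) (suc n) ≤-refl) ⟩
      f 0 ℤ.+ + 0                                                             ≡⟨ ℤₚ.+-identityʳ (f 0) ⟩
      f 0                                                                     ≡⟨ cong f (n∸n≡0 (suc n)) ⟨
      f (suc n ∸ suc n)                                                       ∎

-- A coefficient of index `i` with m ≤ i ≤ n equals the one of index n - i, which lies below `m`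
-- because n < 2m.
Palindromic-vanishes : ∀ {n r} m → Palindromic n r → n < m + m → (∀ i → i < m → coeff i r ≡ + 0) → r ≐ []
Palindromic-vanishes {n} {r} m (palindromic b e) n<2m low = coeffs vanish
  where
  vanish : ∀ i → coeff i r ≡ + 0
  vanish i with i <? m | i ≤? n
  ... | yes i<m | _       = low i i<m
  ... | no _    | no i≰n  = b i (≰⇒> i≰n)
  ... | no i≮m  | yes i≤n = begin
    coeff i r                  ≡⟨ at e i ⟨
    coeff i (reversal n r)     ≡⟨ coeff-reversalSeq n (λ i → coeff i r) i i≤n ⟩
    coeff (n ∸ i) r            ≡⟨ low (n ∸ i) n-i<m ⟩
    + 0                        ∎
    where
    open ≡-Reasoning
    n-i<m : n ∸ i < m
    n-i<m = +-cancelʳ-< i (n ∸ i) m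
      (≤-<-trans (≤-reflexive (m∸n+n≡m i≤n)) (<-≤-trans n<2m (+-monoʳ-≤ m (≮⇒≥ i≮m))))

⌊n/2⌋-lower : ∀ n → ⌊ n /2⌋ + ⌊ n /2⌋ ≤ n
⌊n/2⌋-lower n = ≤-trans (+-monoʳ-≤ ⌊ n /2⌋ (⌊n/2⌋≤⌈n/2⌉ n)) (≤-reflexive (⌊n/2⌋+⌈n/2⌉≡n n))

⌊n/2⌋-upper : ∀ n → n < suc ⌊ n /2⌋ + suc ⌊ n /2⌋
⌊n/2⌋-upper zero          = s≤s z≤n
⌊n/2⌋-upper (suc zero)    = s≤s (s≤s z≤n)
⌊n/2⌋-upper (suc (suc n)) = s≤s (subst (suc (suc n) ≤_) (≡.sym (+-suc (suc ⌊ n /2⌋) (suc ⌊ n /2⌋))) (s≤s (⌊n/2⌋-upper n)))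

InRange-half : ∀ φn → InRange φn (suc ⌊ φn /2⌋) 0
InRange-half φn i i≤ = ≤-trans (+-mono-≤ (s≤s⁻¹ i≤) (s≤s⁻¹ i≤)) (⌊n/2⌋-lower φn)

-- The number of rounds, one more than half the degree, is just enough to clear the lower half
-- including a middle coefficient; symmetry clears the upper half.
remainder-Φ : ∀ N → 2 ≤ N → remainder (totient N) (suc ⌊ totient N /2⌋) 0 (Φ N) ≐ []
remainder-Φ N 2≤N = Palindromic-vanishes (suc ⌊ totient N /2⌋)
  (Palindromic-remainder (totient N) (suc ⌊ totient N /2⌋) 0 (Φ N) (InRange-half (totient N))
    (palindromic (bound-Φ N) (palindromic-Φ N 2≤N)))
  (⌊n/2⌋-upper (totient N))
  (coeff-remainder-low (totient N) (suc ⌊ totient N /2⌋) 0 (Φ N) λ _ ())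

module LucasCyclotomic {c ℓ} (R : CommutativeRing c ℓ) {x y s t : CommutativeRing.Carrier R}
  (roots : Roots R x y s t) where
  open RingNotation R
  open Homogenization R x y
  open LucasEvaluation R roots
  open ≈-Reasoning

  lucas-homog : ∀ N → 2 ≤ N → lucas R N s t ≈ homog (totient N) (Φ N)
  lucas-homog 1               (s≤s ())
  lucas-homog N@(suc (suc _)) 2≤N = sym (begin
    homog φn (Φ N)                                               ≈⟨ lucasSum-homog φn (suc ⌊ φn /2⌋) 0 (Φ N) (InRange-half φn) ⟩
    lucas R N s t ⊞ homog φn (remainder φn (suc ⌊ φn /2⌋) 0 (Φ N))
                                                                 ≈⟨ ⊞-congˡ (trans (homog-cong φn (remainder-Φ N 2≤N)) (homogSeq-zero φn λ _ → ≡.refl)) ⟩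
    lucas R N s t ⊞ 0#                                           ≈⟨ ⊞-identityʳ _ ⟩
    lucas R N s t                                                ∎)
    where
    φn = totient N

-- The quadratic extension

module LucasHomomorphism {c ℓ c′ ℓ′} (R : CommutativeRing c ℓ) (E : CommutativeRing c′ ℓ′)
  (h : CommutativeRing.Carrier R → CommutativeRing.Carrier E)
  (h-hom : IsRingHomomorphism (CommutativeRing.rawRing R) (CommutativeRing.rawRing E) h) where
  open IsRingHomomorphism h-hom
  open RingNotation E
  private module R = RingNotation R

  fromℕR-hom : ∀ n → h (fromℕR R n) ≈ fromℕR E n
  fromℕR-hom zero    = 0#-homo
  fromℕR-hom (suc n) = trans (+-homo _ _) (⊞-cong 1#-homo (fromℕR-hom n))

  fromℤR-hom : ∀ z → h (fromℤR R z) ≈ fromℤR E z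
  fromℤR-hom (+ n)    = fromℕR-hom n
  fromℤR-hom -[1+ n ] = trans (-‿homo _) (⊟-cong (fromℕR-hom (suc n)))

  powR-hom : ∀ x k → h (powR R x k) ≈ powR E (h x) k
  powR-hom x zero    = 1#-homo
  powR-hom x (suc k) = trans (*-homo _ _) (·-congˡ (powR-hom x k))

  lucasSum-hom : ∀ φn j γs s t → h (lucasSum R φn j γs s t) ≈ lucasSum E φn j γs (h s) (h t)
  lucasSum-hom φn j []       s t = 0#-homo
  lucasSum-hom φn j (γ ∷ γs) s t = trans (+-homo _ _) (⊞-cong
    (trans (*-homo _ _) (·-cong (trans (*-homo _ _) (·-cong (fromℤR-hom γ) (powR-hom s (φn ∸ (j + j)))))
      (trans (powR-hom (R.⊟ t) j) (RingPowers.^^-cong E j (-‿homo t)))))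
    (lucasSum-hom φn (suc j) γs s t))

  -- Allows a Lucas atom over R to be evaluated in an extension where `s` and `t` have roots.
  lucas-hom : ∀ N s t → h (lucas R N s t) ≈ lucas E N (h s) (h t)
  lucas-hom 0             s t = lucasSum-hom (totient 0) 0 (gammas 0) s t
  lucas-hom 1             s t = 1#-homo
  lucas-hom (suc (suc N)) s t = lucasSum-hom (totient (2 + N)) 0 (gammas (2 + N)) s t

-- R[X] / (X² - s X - t), with a + b X stored as the pair (a , b): here s and - t are the
-- sum and the product of X and s - X.
module QuadraticExtension {c ℓ} (R : CommutativeRing c ℓ) (s t : CommutativeRing.Carrier R) where
  open RingNotation R
  open IntegerSolver R

  infix 4 _≈ₑ_

  record _≈ₑ_ (u v : Carrier × Carrier) : Set ℓ where
    constructor _,_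
    field
      part₀ : proj₁ u ≈ proj₁ v
      part₁ : proj₂ u ≈ proj₂ v

  open _≈ₑ_ public

  _+ₑ_ _*ₑ_ : Carrier × Carrier → Carrier × Carrier → Carrier × Carrier
  (a , b) +ₑ (c , d) = a ⊞ c , b ⊞ d
  (a , b) *ₑ (c , d) = a · c ⊞ t · (b · d) , a · d ⊞ b · c ⊞ s · (b · d)

  *ₑ-comm : ∀ u v → u *ₑ v ≈ₑ v *ₑ u
  *ₑ-comm (a , b) (c , d) =
    solve 5 (λ a b c d t → a :* c :+ t :* (b :* d) := c :* a :+ t :* (d :* b)) refl a b c d t ,
    solve 5 (λ a b c d s → a :* d :+ b :* c :+ s :* (b :* d) := c :* b :+ d :* a :+ s :* (d :* b)) refl a b c d s

  *ₑ-cong : ∀ {u v w z} → u ≈ₑ v → w ≈ₑ z → u *ₑ w ≈ₑ v *ₑ z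
  *ₑ-cong (e , f) (e′ , f′) =
    ⊞-cong (·-cong e e′) (·-congˡ (·-cong f f′)) ,
    ⊞-cong (⊞-cong (·-cong e f′) (·-cong f e′)) (·-congˡ (·-cong f f′))

  *ₑ-assoc : ∀ u v w → (u *ₑ v) *ₑ w ≈ₑ u *ₑ (v *ₑ w)
  *ₑ-assoc (a , b) (c , d) (e , f) =
    solve 8 (λ a b c d e f s t →
      (a :* c :+ t :* (b :* d)) :* e :+ t :* ((a :* d :+ b :* c :+ s :* (b :* d)) :* f) :=
      a :* (c :* e :+ t :* (d :* f)) :+ t :* (b :* (c :* f :+ d :* e :+ s :* (d :* f))))
      refl a b c d e f s t ,
    solve 8 (λ a b c d e f s t →
      (a :* c :+ t :* (b :* d)) :* f :+ (a :* d :+ b :* c :+ s :* (b :* d)) :* e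
        :+ s :* ((a :* d :+ b :* c :+ s :* (b :* d)) :* f) :=
      a :* (c :* f :+ d :* e :+ s :* (d :* f)) :+ b :* (c :* e :+ t :* (d :* f))
        :+ s :* (b :* (c :* f :+ d :* e :+ s :* (d :* f))))
      refl a b c d e f s t

  *ₑ-identityˡ : ∀ u → (1# , 0#) *ₑ u ≈ₑ u
  *ₑ-identityˡ (a , b) =
    solve 3 (λ a b t → con (+ 1) :* a :+ t :* (con (+ 0) :* b) := a) refl a b t ,
    solve 3 (λ a b s → con (+ 1) :* b :+ con (+ 0) :* a :+ s :* (con (+ 0) :* b) := b) refl a b s

  *ₑ-distribˡ : ∀ u v w → u *ₑ (v +ₑ w) ≈ₑ (u *ₑ v) +ₑ (u *ₑ w)
  *ₑ-distribˡ (a , b) (c , d) (e , f) =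
    solve 7 (λ a b c d e f t → a :* (c :+ e) :+ t :* (b :* (d :+ f))
      := (a :* c :+ t :* (b :* d)) :+ (a :* e :+ t :* (b :* f))) refl a b c d e f t ,
    solve 7 (λ a b c d e f s → a :* (d :+ f) :+ b :* (c :+ e) :+ s :* (b :* (d :+ f))
      := (a :* d :+ b :* c :+ s :* (b :* d)) :+ (a :* f :+ b :* e :+ s :* (b :* f))) refl a b c d e f s

  ≈ₑ-trans : ∀ {u v w} → u ≈ₑ v → v ≈ₑ w → u ≈ₑ w
  ≈ₑ-trans (e , f) (e′ , f′) = trans e e′ , trans f f′

  +ₑ-cong : ∀ {u v w z} → u ≈ₑ v → w ≈ₑ z → u +ₑ w ≈ₑ v +ₑ z
  +ₑ-cong (e , f) (e′ , f′) = ⊞-cong e e′ , ⊞-cong f f′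

  extension : CommutativeRing c ℓ
  extension = record
    { Carrier = Carrier × Carrier ; _≈_ = _≈ₑ_ ; _+_ = _+ₑ_ ; _*_ = _*ₑ_
    ; -_ = λ (a , b) → ⊟ a , ⊟ b ; 0# = 0# , 0# ; 1# = 1# , 0#
    ; isCommutativeRing = record
      { isRing = record
        { +-isAbelianGroup = record
          { isGroup = record
            { isMonoid = record
              { isSemigroup = record
                { isMagma = record
                  { isEquivalence = record
                    { refl = refl , refl
                    ; sym = λ (e , f) → sym e , sym f
                    ; trans = ≈ₑ-trans }
                  ; ∙-cong = +ₑ-cong }
                ; assoc = λ _ _ _ → ⊞-assoc _ _ _ , ⊞-assoc _ _ _ }
              ; identity = (λ _ → ⊞-identityˡ _ , ⊞-identityˡ _) , λ _ → ⊞-identityʳ _ , ⊞-identityʳ _ }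
            ; inverse = (λ _ → ⊟-inverseˡ _ , ⊟-inverseˡ _) , λ _ → ⊟-inverseʳ _ , ⊟-inverseʳ _
            ; ⁻¹-cong = λ (e , f) → ⊟-cong e , ⊟-cong f }
          ; comm = λ _ _ → ⊞-comm _ _ , ⊞-comm _ _ }
        ; *-cong = *ₑ-cong
        ; *-assoc = *ₑ-assoc
        ; *-identity = *ₑ-identityˡ , λ u → ≈ₑ-trans (*ₑ-comm u (1# , 0#)) (*ₑ-identityˡ u)
        ; distrib = *ₑ-distribˡ , λ u v w → ≈ₑ-trans (*ₑ-comm (v +ₑ w) u)
            (≈ₑ-trans (*ₑ-distribˡ u v w) (+ₑ-cong (*ₑ-comm u v) (*ₑ-comm u w))) }
      ; *-comm = *ₑ-comm } }

  embed : Carrier → Carrier × Carrier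
  embed a = a , 0#

  embed-hom : IsRingHomomorphism (CommutativeRing.rawRing R) (CommutativeRing.rawRing extension) embed
  embed-hom = record
    { isSemiringHomomorphism = record
      { isNearSemiringHomomorphism = record
        { +-isMonoidHomomorphism = record
          { isMagmaHomomorphism = record
            { isRelHomomorphism = record { cong = λ e → e , refl }
            ; homo = λ _ _ → refl , sym (⊞-identityˡ 0#) }
          ; ε-homo = refl , refl }
        ; *-homo = λ a b →
            solve 3 (λ a b t → a :* b := a :* b :+ t :* (con (+ 0) :* con (+ 0))) refl a b t ,
            solve 3 (λ a b s → con (+ 0) := a :* con (+ 0) :+ con (+ 0) :* b :+ s :* (con (+ 0) :* con (+ 0))) refl a b s }
      ; 1#-homo = refl , refl }
    ; -‿homo = λ _ → refl , sym ⊟0≈0 }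

  root₁ root₂ : Carrier × Carrier
  root₁ = 0# , 1#
  root₂ = s , ⊟ 1#

  roots-sum : embed s ≈ₑ root₁ +ₑ root₂
  roots-sum = sym (⊞-identityˡ s) , sym (⊟-inverseʳ 1#)

  roots-product : embed (⊟ t) ≈ₑ root₁ *ₑ root₂
  roots-product =
    solve 2 (λ s t → :- t := con (+ 0) :* s :+ t :* (con (+ 1) :* (:- con (+ 1)))) refl s t ,
    solve 1 (λ s → con (+ 0) := con (+ 0) :* (:- con (+ 1)) :+ con (+ 1) :* s :+ s :* (con (+ 1) :* (:- con (+ 1)))) refl s

-- Multiplying the index by a prime

module LucasSubstitution {c ℓ} (R : CommutativeRing c ℓ) {x y s t : CommutativeRing.Carrier R}
  (roots : Roots R x y s t)
  (p : ℕ) (p-prime : Prime p) where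
  open RingNotation R
  open RingPowers R
  open Homogenization R x y
  open Composition R x y p
  open LucasCyclotomic R roots
  open Roots roots
  open ≈-Reasoning
  private module Rₚ = Homogenization R (x ^^ p) (y ^^ p)

  -- Homogenization at the roots turns q ↦ q^p into passing to the `p`-th powers of the roots, whose
  -- sum and negated product are the new parameters.
  lucas-*-prime : ∀ M → 2 ≤ M → p ∣ M → ∀ s′ t′ → Roots R (x ^^ p) (y ^^ p) s′ t′ →
                  lucas R (M * p) s t ≈ lucas R M s′ t′
  lucas-*-prime M 2≤M p∣M s′ t′ roots′ = begin
    lucas R (M * p) s t                                             ≈⟨ lucas-homog (M * p) (≤-trans 2≤M (m≤m*n M p)) ⟩
    homog (totient (M * p)) (Φ (M * p))                             ≡⟨ cong (λ n → homog n (Φ (M * p))) (totient-*-∣ p p-prime M 1≤M p∣M) ⟩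
    homog (totient M * p) (Φ (M * p))                               ≈⟨ homog-cong (totient M * p) (≐-sym (substitution-Φ-∣ p p-prime M 1≤M p∣M)) ⟩
    homog (totient M * p) (Substitution.homog p (totient M) (Φ M))  ≈⟨ homog-substitution (totient M) (Φ M) ⟩
    Rₚ.homog (totient M) (Φ M)                                      ≈⟨ LucasCyclotomic.lucas-homog R roots′ M 2≤M ⟨
    lucas R M s′ t′                                                 ∎
    where
    1≤M : 1 ≤ M
    1≤M = <⇒≤ 2≤M
    instance
      p≢0 : NonZero p
      p≢0 = prime⇒nonZero p-prime

  power-sum : ¬ p ∣ 2 → s · lucas R (2 * p) s t ≈ x ^^ p ⊞ y ^^ p
  power-sum p∤2 = begin
    s · lucas R (2 * p) s t                                     ≈⟨ ·-comm s _ ⟩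
    lucas R (2 * p) s t · s                                     ≈⟨ ·-cong (lucas-homog (2 * p) (m≤m*n 2 p)) vieta-sum ⟩
    -- `Φ 2` and `totient 2` compute to `onePlusQ` and 1, so x + y is the homogenization of `Φ 2`
    -- and the total degree takes the form `1 * p`.
    homog (totient (2 * p)) (Φ (2 * p)) · (x ⊞ y)               ≈⟨ ·-congˡ homog-onePlusQ ⟨
    homog (totient (2 * p)) (Φ (2 * p)) · homog 1 (Φ 2)         ≈⟨ homog-⊗ (totient (2 * p)) 1 (Φ (2 * p)) (Φ 2) (bound-Φ (2 * p)) (bound-Φ 2) ⟨
    homog (totient (2 * p) + 1) (Φ (2 * p) ⊗ Φ 2)               ≡⟨ cong (λ n → homog n (Φ (2 * p) ⊗ Φ 2)) (totient-*-∤ p p-prime 2 (s≤s z≤n) p∤2) ⟨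
    homog (1 * p) (Φ (2 * p) ⊗ Φ 2)                             ≈⟨ homog-cong (1 * p) (≐-sym (substitution-Φ-∤ p p-prime 2 (s≤s z≤n) p∤2)) ⟩
    homog (1 * p) (Substitution.homog p 1 (Φ 2))                ≈⟨ homog-substitution 1 (Φ 2) ⟩
    Rₚ.homog 1 onePlusQ                                         ≈⟨ Rₚ.homog-onePlusQ ⟩
    x ^^ p ⊞ y ^^ p                                             ∎
    where
    instance
      p≢0 : NonZero p
      p≢0 = prime⇒nonZero p-prime

theorem5p11 : {c ℓ : Level} (R : CommutativeRing c ℓ) (n p m : ℕ) →
    1 ≤ n → Prime p → ¬ (p ∣ n) → 2 ≤ m →
    (s t : CommutativeRing.Carrier R) →
    (p ≡ 2 →
    CommutativeRing._≈_ R (lucas R (p ^ m * n) s t)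
    (lucas R (p ^ (m ∸ 1) * n)
    (CommutativeRing._+_ R (CommutativeRing._*_ R s s) (CommutativeRing._+_ R t t))
    (CommutativeRing.-_ R (CommutativeRing._*_ R t t))))
    ×
    (3 ≤ p →
    CommutativeRing._≈_ R (lucas R (p ^ m * n) s t)
    (lucas R (p ^ (m ∸ 1) * n)
    (CommutativeRing._*_ R s (lucas R (2 * p) s t))
    (powR R t p)))
theorem5p11 R n p (suc (suc m)) 1≤n p-prime _ (s≤s (s≤s z≤n)) s t = case-two , case-odd
  where
  open QuadraticExtension R s t
  open RingNotation extension
  open RingPowers extension
  open IntegerSolver extension
  open LucasHomomorphism R extension embed embed-hom
  open IsRingHomomorphism embed-hom using (+-homo; *-homo; -‿homo)
  open ≈-Reasoning
  module R = RingNotation R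

  ŝ t̂ : Carrier
  ŝ = embed s
  t̂ = embed t

  -t̂≈xy : ⊟ t̂ ≈ root₁ · root₂
  -t̂≈xy = trans (sym (-‿homo t)) roots-product

  open LucasSubstitution extension {t = t̂} (roots-sum , -t̂≈xy) p p-prime

  M : ℕ
  M = p ^ suc m * n

  instance
    p≢0 : NonZero p
    p≢0 = prime⇒nonZero p-prime

  -- The exponent `suc m` is positive, so `M` retains a factor `p` and the substitution rule has no
  -- extra factor `Φ M`.
  p∣M : p ∣ M
  p∣M = ∣-trans (m∣m*n (p ^ m)) (m∣m*n n)

  2≤M : 2 ≤ M
  2≤M = ≤-trans (nonTrivial⇒n>1 p {{prime⇒nonTrivial p-prime}})
    (∣⇒≤ {{>-nonZero (*-mono-≤ (m^n>0 p (suc m)) 1≤n)}} p∣M)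

  p^m≡Mp : p ^ suc (suc m) * n ≡ M * p
  p^m≡Mp = ≡.trans (*-assoc p (p ^ suc m) n) (*-comm p M)

  -- `embed` is injective, its first component being the identity, so an equation between images
  -- holds in R. Only the Vieta relations of the new parameters are left to check.
  descend : ∀ s′ t′ → Roots extension (root₁ ^^ p) (root₂ ^^ p) (embed s′) (embed t′) →
            lucas R (p ^ suc (suc m) * n) s t R.≈ lucas R M s′ t′
  descend s′ t′ roots = part₀ (begin
    embed (lucas R (p ^ suc (suc m) * n) s t)   ≡⟨ cong (λ N → embed (lucas R N s t)) p^m≡Mp ⟩
    embed (lucas R (M * p) s t)                 ≈⟨ lucas-hom (M * p) s t ⟩
    lucas extension (M * p) ŝ t̂                 ≈⟨ lucas-*-prime M 2≤M p∣M (embed s′) (embed t′) roots ⟩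
    lucas extension M (embed s′) (embed t′)     ≈⟨ lucas-hom M s′ t′ ⟨
    embed (lucas R M s′ t′)                     ∎)

  case-two : p ≡ 2 → lucas R (p ^ suc (suc m) * n) s t R.≈
                     lucas R M (s R.· s R.⊞ (t R.⊞ t)) (R.⊟ (t R.· t))
  case-two ≡.refl = descend _ _ ((begin
      embed (s R.· s R.⊞ (t R.⊞ t))                           ≈⟨ trans (+-homo _ _) (⊞-cong (*-homo s s) (+-homo t t)) ⟩
      -- It is `⊟ t̂` that equals the product of the roots, so 2t is written as minus twice `⊟ t̂`;
      -- the sum then becomes (x + y)² - 2xy.
      ŝ · ŝ ⊞ (t̂ ⊞ t̂)                                         ≈⟨ solve 2 (λ s t → s :* s :+ (t :+ t) := s :* s :+ :- ((:- t) :+ (:- t))) refl ŝ t̂ ⟩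
      ŝ · ŝ ⊞ ⊟ (⊟ t̂ ⊞ ⊟ t̂)                                   ≈⟨ ⊞-cong (·-cong roots-sum roots-sum) (⊟-cong (⊞-cong -t̂≈xy -t̂≈xy)) ⟩
      (x ⊞ y) · (x ⊞ y) ⊞ ⊟ (x · y ⊞ x · y)                   ≈⟨ solve 2 (λ x y → (x :+ y) :* (x :+ y) :+ :- (x :* y :+ x :* y)
                                                                   := x :* (x :* con (+ 1)) :+ y :* (y :* con (+ 1))) refl x y ⟩
      x ^^ 2 ⊞ y ^^ 2                                         ∎) , (begin
      ⊟ embed (R.⊟ (t R.· t))                                 ≈⟨ ⊟-cong (trans (-‿homo _) (⊟-cong (*-homo t t))) ⟩
      ⊟ ⊟ (t̂ · t̂)                                             ≈⟨ solve 1 (λ t → :- (:- (t :* t)) := (:- t) :* (:- t)) refl t̂ ⟩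
      ⊟ t̂ · ⊟ t̂                                               ≈⟨ ·-cong -t̂≈xy -t̂≈xy ⟩
      x · y · (x · y)                                         ≈⟨ solve 2 (λ x y → x :* y :* (x :* y) := x :* (x :* con (+ 1)) :* (y :* (y :* con (+ 1)))) refl x y ⟩
      x ^^ 2 · y ^^ 2                                         ∎))
    where
    x y : Carrier
    x = root₁
    y = root₂

  case-odd : 3 ≤ p → lucas R (p ^ suc (suc m) * n) s t R.≈
                     lucas R M (s R.· lucas R (2 * p) s t) (powR R t p)
  case-odd 3≤p = descend _ _ ((begin
      embed (s R.· lucas R (2 * p) s t)           ≈⟨ trans (*-homo _ _) (·-congˡ (lucas-hom (2 * p) s t)) ⟩
      ŝ · lucas extension (2 * p) ŝ t̂             ≈⟨ power-sum (λ p∣2 → <⇒≱ 3≤p (∣⇒≤ p∣2)) ⟩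
      root₁ ^^ p ⊞ root₂ ^^ p                     ∎) , (begin
      ⊟ embed (powR R t p)                        ≈⟨ ⊟-cong (powR-hom t p) ⟩
      -- An odd exponent lets the sign move inside the power, where `⊟ t̂` is the product of the
      -- roots.
      ⊟ (t̂ ^^ p)                                  ≈⟨ Negation.odd-power-neg extension t̂ p 2∤p ⟩
      (⊟ t̂) ^^ p                                  ≈⟨ ^^-cong p -t̂≈xy ⟩
      (root₁ · root₂) ^^ p                        ≈⟨ ·-^^ root₁ root₂ p ⟩
      root₁ ^^ p · root₂ ^^ p                     ∎))
    where
    2∤p : ¬ 2 ∣ p
    2∤p 2∣p with prime⇒irreducible p-prime 2∣p
    ... | inj₁ ()
    ... | inj₂ 2≡p = <⇒≢ 3≤p 2≡p
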